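{- Let $r,s,\ell,k,m$ be positive integers with $r\ge s$, $\ell\ge k$, $r\ge\ell$, $s\ge k$, and $k\ell\le m\le rs$. Let $G=G[U,W]$ be a bipartite graph with parts $U$ and $W$, $|U|=r$, $|W|=s$, and exactly $m$ edges. Suppose that there exists a subset $I\subseteq W$ with $|I|=k$ and $\delta_G(I)\ge \ell$. Then $$N(S_2,G)\le\begin{cases} N\big(S_2,B_1(r,s,m,\ell,k)\big), & \text{if } m\le rk \text{ and } k+\ell\le r,\\ N\big(S_2,B_2(r,s,m,\ell,k)\big), & \text{if } m\le rk \text{ and } k+\ell>r,\\ N\big(S_2,B(r,s,m)\big), & \text{if } m\ge rk.\end{cases}$$
   Context: All graphs are finite and simple. $S_2$ denotes the star with two edges. $N(S_2,G)$ is the number of (not necessarily induced) subgraphs of $G$ isomorphic to $S_2$, i.e. $N(S_2,G)=\sum_{v\in V(G)}\binom{d_G(v)}{2}$, where $d_G(v)$ is the degree of $v$. For $S\subseteq V(G)$, $\delta_G(S)=\min\{d_G(v):v\in S\}$. For a positive integer $t$, $[t]=\{1,\dots,t\}$, $[0]=\emptyset$, and for integers $a\le b$, $[a,b]=\{a,\dots,b\}$, with $[a,b]=\emptyset$ if $a>b$. All of the following bipartite graphs have parts $\{u_1,\dots,u_r\}$ and $\{w_1,\dots,w_s\}$. - $B(r,s,m)$, for $m\le rs$ and $r\ge s$: write $m=rp+q$ with integers $p\ge0$, $0\le q\le r-1$. The edge set is $\{\{u_i,w_j\}:(i,j)\in[r]\times[p]\}\cup\{\{u_i,w_{p+1}\}: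 i\in[q]\}$. - $B_1(r,s,m,\ell,k)$, for $r\ge\ell$, $s\ge k$, $k\ell\le m\le rk$ (used when $r>\ell$): write $m=k\ell+p(r-\ell)+q$ with integers $p\ge0$, $0\le q\le r-\ell-1$. The edge set is the union of $\{\{u_i,w_j\}:(i,j)\in[r]\times[p]\}$, $\{\{u_i,w_{p+1}\}:i\in[\ell+q]\}$ (this second set is omitted if $p=k$, which happens only when $m=rk$), and $\{\{u_i,w_j\}:(i,j)\in[\ell]\times[p+2,k]\}$. - $B_2(r,s,m,\ell,k)$, for $r\ge\ell$, $s\ge k$, $k\ell\le m\le rk$: write $m=k\ell+pk+q$ with integers $p\ge0$, $0\le q\le k-1$. The edge set is $\{\{u_i,w_j\}:(i,j)\in[\ell+p]\times[k]\}\cup\{\{u_{\ell+p+1},w_i\}:i\in[q]\}$. -}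

module Defs where

open import Algebra.Properties.Semiring.Sum using (sum)
open import Data.Bool using (Bool)
open import Data.Fin using (Fin; toℕ)
open import Data.Fin.Subset using (Subset; ∣_∣)
open import Data.Fin.Subset.Properties using (_∈?_)
open import Data.List using (allFin; filter; map)
open import Data.List.Extrema.Nat using (min)
open import Data.Nat
open import Data.Nat.Combinatorics using (_C_)
open import Data.Nat.DivMod using (_/_; _%_)
open import Data.Nat.Properties
open import Data.Sum using (_⊎_; inj₁; inj₂)
open import Data.Vec using (tabulate)
open import Function using (_∘_)
open import Relation.Nullary.Decidable using (does; ¬?; _×-dec_; _⊎-dec_)

∑ : ∀ {n} → (Fin n → ℕ) → ℕ
∑ = sum +-*-semiring

-- A bipartite graph with parts U = Fin r and W = Fin s, given by its
-- biadjacency matrix; its vertex set is Fin r ⊎ Fin s.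
BipartiteGraph : ℕ → ℕ → Set
BipartiteGraph r s = Fin r → Fin s → Bool

module _ {r s : ℕ} (G : BipartiteGraph r s) where

  degree : Fin r ⊎ Fin s → ℕ
  degree (inj₁ u) = ∣ tabulate (λ w → G u w) ∣
  degree (inj₂ w) = ∣ tabulate (λ u → G u w) ∣

  -- Every edge has exactly one end in U.
  edges : ℕ
  edges = ∑ λ u → ∣ tabulate (λ w → G u w) ∣

  -- N(S₂, G): a copy of S₂ is a centre together with two of its neighbours.
  N-S₂ : ℕ
  N-S₂ = (∑ λ u → degree (inj₁ u) C 2) + (∑ λ w → degree (inj₂ w) C 2)

  -- δ_G(I) for I ⊆ W.  The first argument of min only matters for I = ∅:
  -- no vertex of W has degree exceeding r.
  δ : Subset s → ℕ
  δ I = min r (map (degree ∘ inj₂) (filter (_∈? I) (allFin s)))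

-- The vertex in position zero of Fin n is the one with subscript 1.
index : ∀ {n} → Fin n → ℕ
index = suc ∘ toℕ

-- m = rp + q.
B : ∀ r s (m : ℕ) .{{_ : NonZero r}} → BipartiteGraph r s
B r s m u w = does
  (   (j ≤? p)
  ⊎-dec (j ≟ suc p ×-dec i ≤? q))
  where
  i = index u
  j = index w
  p = m / r
  q = m % r

-- m = kℓ + p(r - ℓ) + q; the instance argument says ℓ < r; meant for k ≤ s and kℓ ≤ m ≤ rk.
B₁ : ∀ r s (m ℓ k : ℕ) .{{_ : NonZero (r ∸ ℓ)}} → BipartiteGraph r s
B₁ r s m ℓ k u w = does
  (   (j ≤? p)
  ⊎-dec (¬? (p ≟ k) ×-dec j ≟ suc p ×-dec i ≤? ℓ + q)
  ⊎-dec (i ≤? ℓ ×-dec p + 2 ≤? j ×-dec j ≤? k))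
  where
  i = index u
  j = index w
  p = (m ∸ k * ℓ) / (r ∸ ℓ)
  q = (m ∸ k * ℓ) % (r ∸ ℓ)

-- m = kℓ + pk + q; meant for ℓ ≤ r, k ≤ s and kℓ ≤ m ≤ rk.
B₂ : ∀ r s (m ℓ k : ℕ) .{{_ : NonZero k}} → BipartiteGraph r s
B₂ r s m ℓ k u w = does
  (   (i ≤? ℓ + p ×-dec j ≤? k)
  ⊎-dec (i ≟ suc (ℓ + p) ×-dec j ≤? q))
  where
  i = index u
  j = index w
  p = (m ∸ k * ℓ) / k
  q = (m ∸ k * ℓ) % k

k+ℓ≤r⇒r∸ℓ≢0 : ∀ {k ℓ r} .{{_ : NonZero k}} → k + ℓ ≤ r → NonZero (r ∸ ℓ)
k+ℓ≤r⇒r∸ℓ≢0 {k} {ℓ} k+ℓ≤r =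
  >-nonZero (m<n⇒0<n∸m (≤-trans (m<n+m ℓ (>-nonZero⁻¹ k)) k+ℓ≤r))

{-# OPTIONS --safe #-}

-- For the degrees c of the vertices of W, counting the pairs of common
-- neighbours gives N(S₂, G) ≤ Σ C(cᵢ, 2) + Σ_{i<j} min(cᵢ, cⱼ) = weight c, with
-- equality when the neighbourhoods are nested; for sorted c, this is the sum of
-- i + j over the cells (i, j), counted from zero, of the diagram with column
-- heights c.  Let packed h n be the weight of n cells in columns of height h,
-- all but the last one full.  A diagram of n cells in an h × h square has weight
-- at most packed h n (Ahlswede and Katona), which settles m ≥ rk.
--
-- If m ≤ rk, let t ≥ ℓ be the k-th largest degree.  The diagram consists of a
-- rectangle of k columns of height t, a part above it and a part to its right.
-- Since packed (h + y) n ≤ packed h n + y n and t ≥ k, the right part can be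
-- traded for cells above the rectangle, and packed h is superadditive, so that
-- the two parts merge into one.  The outcome has only k columns; what lies above
-- row ℓ is then a diagram in an (r - ℓ) × k box, to which the first bound applies.
module Submission where

open import Defs
import Algebra.Properties.Semiring.Sum as SemiringSum
open import Data.Bool using (Bool; true; false; _∧_)
open import Data.Bool.Properties using (∧-zeroʳ)
open import Data.Fin using (Fin; toℕ) renaming (zero to fzero; suc to fsuc)
open import Data.Fin.Properties using (toℕ<n)
open import Data.Fin.Subset using (Subset; inside; outside; ∣_∣) renaming (_∈_ to _∈ₛ_)
open import Data.Fin.Subset.Properties using () renaming (_∈?_ to _∈ₛ?_)
open import Data.List using (List; []; _∷_; _++_; map; length; replicate; tabulate)
open import Data.List.Extrema.Nat using (min≤xs)
open import Data.List.Membership.Propositional using (_∈_)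
open import Data.List.Membership.Propositional.Properties using (∈-∃++; ∈-map⁺; ∈-filter⁺; ∈-allFin)
import Data.List.Membership.DecPropositional as DecMembership
open import Data.List.Properties
  using (length-map; length-replicate; length-++; length-tabulate; map-∘; map-++; map-cong)
open import Data.List.Relation.Binary.Permutation.Propositional
  using (_↭_; ↭-refl; ↭-sym; ↭-trans; prep; swap)
  renaming (refl to refl↭; trans to trans↭)
open import Data.List.Relation.Binary.Permutation.Propositional.Properties
  using (All-resp-↭; ↭-length; shift; map⁺; ∷↭∷ʳ; ++⁺ʳ)
open import Data.List.Relation.Unary.All as All using (All; []; _∷_)
import Data.List.Relation.Unary.All.Properties as Allₚ
open import Data.Nat
open import Data.Nat.Combinatorics using (_C_; nC1≡n; nCk+nC[k+1]≡[n+1]C[k+1])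
open import Data.Nat.DivMod
open import Data.Nat.Induction using (<-wellFounded)
open import Data.Nat.ListAction using (sum)
open import Data.Nat.ListAction.Properties using (sum-++; sum-↭)
open import Data.Nat.Properties
open import Data.Nat.Tactic.RingSolver using (solve-∀)
open import Data.Product using (_×_; _,_; ∃; ∃₂; Σ-syntax; proj₁)
open import Data.Sum as Sum using (_⊎_; inj₁; inj₂)
open import Data.Vec as Vec using ([]; _∷_; here; there)
open import Function using (_∘_; mk⇔; _⇔_)
open import Induction.WellFounded using (Acc; acc)
open import Relation.Binary using (tri<; tri≈; tri>)
open import Relation.Binary.PropositionalEquality
open import Relation.Nullary using (¬_; yes; no; contradiction)
open import Relation.Nullary.Decidable using (does-⇔; ¬?; _×-dec_; _⊎-dec_)

open DecMembership _≟_ using (_∈?_)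
module ∑ₚ = SemiringSum +-*-semiring

-- Packed columns

-- The recursive form of `n C 2`. It unfolds on successors, which keeps the identities below within
-- reach of the ring solver.
tri : ℕ → ℕ
tri zero    = 0
tri (suc n) = n + tri n

nC2≡tri : ∀ n → n C 2 ≡ tri n
nC2≡tri zero    = refl
nC2≡tri (suc n) = trans (sym (nCk+nC[k+1]≡[n+1]C[k+1] n 1))
                        (cong₂ _+_ (nC1≡n n) (nC2≡tri n))

tri-+ : ∀ m n → tri (m + n) ≡ tri m + tri n + m * n
tri-+ zero    n = sym (+-identityʳ (tri n))
tri-+ (suc m) n = trans (cong (m + n +_) (tri-+ m n)) (lemma m n (tri m) (tri n))
  where
  lemma : ∀ m n a b → m + n + (a + b + m * n) ≡ m + a + b + (n + m * n)
  lemma = solve-∀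

tri-mono-+ : ∀ m n → tri m + tri n ≤ tri (m + n)
tri-mono-+ m n = ≤-trans (m≤m+n _ (m * n)) (≤-reflexive (sym (tri-+ m n)))

-- The sum of `i + j` over `p` columns of height `h` and a last column of `q` cells: row numbers
-- give `p * tri h` and `tri q`, column numbers give `h * tri p` and `p * q`.
packed′ : ℕ → ℕ → ℕ → ℕ
packed′ h p q = p * tri h + h * tri p + tri q + p * q

packed : (h : ℕ) .{{_ : NonZero h}} → ℕ → ℕ
packed h n = packed′ h (n / h) (n % h)

-- A full first column weighs `tri h`; the `n` cells behind it stand one column further right than
-- in `packed h n`.
packed-+ : ∀ h .{{_ : NonZero h}} n → packed h (h + n) ≡ tri h + n + packed h n
packed-+ h n = begin
  packed′ h ((h + n) / h) ((h + n) % h)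
    ≡⟨ cong₂ (packed′ h) quotient (trans (cong (_% h) (+-comm h n)) ([m+n]%n≡m%n n h)) ⟩
  packed′ h (suc (n / h)) (n % h)
    ≡⟨ lemma h (n / h) (n % h) (tri h) (tri (n / h)) (tri (n % h)) ⟩
  tri h + (n % h + n / h * h) + packed h n
    ≡⟨ cong (λ z → tri h + z + packed h n) (m≡m%n+[m/n]*n n h) ⟨
  tri h + n + packed h n
    ∎
  where
  open ≡-Reasoning
  quotient : (h + n) / h ≡ suc (n / h)
  quotient = trans (m/n≡1+[m∸n]/n (m≤m+n h n)) (cong (λ z → suc (z / h)) (m+n∸m≡n h n))
  lemma : ∀ h p q a b c →
          a + p * a + h * (p + b) + c + (q + p * q) ≡ a + (q + p * h) + (p * a + h * b + c + p * q)
  lemma = solve-∀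

packed-< : ∀ h .{{_ : NonZero h}} {n} → n < h → packed h n ≡ tri n
packed-< h {n} n<h = trans (cong₂ (packed′ h) (m<n⇒m/n≡0 n<h) (m<n⇒m%n≡m n<h)) (lemma h (tri n))
  where
  lemma : ∀ h a → h * 0 + a + 0 ≡ a
  lemma = solve-∀

packed-self : ∀ h .{{_ : NonZero h}} → packed h h ≡ tri h
packed-self h = begin
  packed h h             ≡⟨ cong (λ z → packed h z) (+-identityʳ h) ⟨
  packed h (h + 0)       ≡⟨ packed-+ h 0 ⟩
  tri h + 0 + packed h 0 ≡⟨ cong (tri h + 0 +_) (packed-< h (>-nonZero⁻¹ h)) ⟩
  tri h + 0 + 0          ≡⟨ trans (+-identityʳ _) (+-identityʳ _) ⟩
  tri h                  ∎
  where open ≡-Reasoning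

packed-≤ : ∀ h .{{_ : NonZero h}} {n} → n ≤ h → packed h n ≡ tri n
packed-≤ h n≤h with m≤n⇒m<n∨m≡n n≤h
... | inj₁ n<h  = packed-< h n<h
... | inj₂ refl = packed-self h

-- The case `q = h` is included, where the last column is full and `p` is no longer the quotient. So
-- cells can be counted in whatever form a construction yields.
packed-*+ : ∀ h .{{_ : NonZero h}} p {q} → q ≤ h → packed h (p * h + q) ≡ packed′ h p q
packed-*+ h zero    {q} q≤h = trans (packed-≤ h q≤h) (lemma h (tri q))
  where
  lemma : ∀ h a → a ≡ h * 0 + a + 0
  lemma = solve-∀
packed-*+ h (suc p) {q} q≤h = begin
  packed h (h + p * h + q)                 ≡⟨ cong (λ z → packed h z) (+-assoc h (p * h) q) ⟩
  packed h (h + (p * h + q))               ≡⟨ packed-+ h (p * h + q) ⟩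
  tri h + (p * h + q) + packed h (p * h + q) ≡⟨ cong (tri h + (p * h + q) +_) (packed-*+ h p q≤h) ⟩
  tri h + (p * h + q) + packed′ h p q      ≡⟨ lemma h p q (tri h) (tri p) (tri q) ⟩
  packed′ h (suc p) q                      ∎
  where
  open ≡-Reasoning
  lemma : ∀ h p q a b c →
          a + (p * h + q) + (p * a + h * b + c + p * q) ≡ a + p * a + h * (p + b) + c + (q + p * q)
  lemma = solve-∀

-- Convexity: two arguments pushed apart at constant sum gain exactly `q * v`.
tri-convex : ∀ q t v → tri (t + v) + tri (t + q) ≤ tri (t + q + v) + tri t
tri-convex q t v = ≤-trans (m≤m+n _ (q * v)) (≤-reflexive (begin
  tri (t + v) + tri (t + q) + q * v
    ≡⟨ cong (λ z → z + tri (t + q) + q * v) (tri-+ t v) ⟩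
  tri t + tri v + t * v + tri (t + q) + q * v
    ≡⟨ lemma t q v (tri t) (tri v) (tri (t + q)) ⟩
  tri (t + q) + tri v + (t + q) * v + tri t
    ≡⟨ cong (_+ tri t) (tri-+ (t + q) v) ⟨
  tri (t + q + v) + tri t ∎))
  where
  open ≡-Reasoning
  lemma : ∀ t q v a b c → a + b + t * v + c + q * v ≡ c + b + (t + q) * v + a
  lemma = solve-∀

-- Full columns are peeled off either summand; the cells behind such a column only become more
-- numerous in the union. Two partial columns either fit into one, or fill one and overflow into
-- another, where convexity applies.
packed-superadditive : ∀ h .{{_ : NonZero h}} a b → packed h a + packed h b ≤ packed h (a + b)
packed-superadditive h a b = go a b (<-wellFounded (a + b))
  where
  open ≤-Reasoning
  go : ∀ a b → Acc _<_ (a + b) → packed h a + packed h b ≤ packed h (a + b)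
  full : ∀ a b → packed h a + packed h b ≤ packed h (a + b) → packed h (h + a) + packed h b ≤ packed h (h + a + b)
  full a b ih = begin
    packed h (h + a) + packed h b             ≡⟨ cong (_+ packed h b) (packed-+ h a) ⟩
    tri h + a + packed h a + packed h b       ≡⟨ +-assoc (tri h + a) _ _ ⟩
    tri h + a + (packed h a + packed h b)     ≤⟨ +-mono-≤ (+-monoʳ-≤ (tri h) (m≤m+n a b)) ih ⟩
    tri h + (a + b) + packed h (a + b)        ≡⟨ packed-+ h (a + b) ⟨
    packed h (h + (a + b))                    ≡⟨ cong (λ z → packed h z) (+-assoc h a b) ⟨
    packed h (h + a + b)                      ∎
  go a b (acc rs) with h ≤? a | h ≤? b | h ≤? a + b
  ... | yes h≤a | _ | _ with m≤n⇒∃[o]m+o≡n h≤a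
  ...   | a′ , refl = full a′ b (go a′ b (rs (+-monoˡ-< b (m<n+m a′ (>-nonZero⁻¹ h)))))
  go a b (acc rs) | no _ | yes h≤b | _ with m≤n⇒∃[o]m+o≡n h≤b
  ...   | b′ , refl = begin
    packed h a + packed h (h + b′) ≡⟨ +-comm (packed h a) _ ⟩
    packed h (h + b′) + packed h a ≤⟨ full b′ a (subst₂ _≤_ (+-comm (packed h a) _) (cong (λ z → packed h z) (+-comm a b′)) (go a b′ (rs (+-monoʳ-< a (m<n+m b′ (>-nonZero⁻¹ h)))))) ⟩
    packed h (h + b′ + a)          ≡⟨ cong (λ z → packed h z) (+-comm _ a) ⟩
    packed h (a + (h + b′))        ∎
  go a b (acc rs) | no a≱h | no b≱h | no a+b≱h = begin
    packed h a + packed h b ≡⟨ cong₂ _+_ (packed-< h (≰⇒> a≱h)) (packed-< h (≰⇒> b≱h)) ⟩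
    tri a + tri b           ≤⟨ tri-mono-+ a b ⟩
    tri (a + b)             ≡⟨ packed-< h (≰⇒> a+b≱h) ⟨
    packed h (a + b)        ∎
  go a b (acc rs) | no a≱h | no b≱h | yes h≤a+b
    with m≤n⇒∃[o]m+o≡n h≤a+b | m≤n⇒∃[o]m+o≡n (<⇒≤ (≰⇒> a≱h))
  -- `a` lacks `u` cells to fill a column. `b` supplies them, and the `t` cells left over number at
  -- most `a`, because `b` is below the column height.
  ... | t , h+t≡a+b | u , refl = begin
    packed h′ a + packed h′ b    ≡⟨ cong₂ _+_ (packed-< h′ (≰⇒> a≱h)) (packed-< h′ (≰⇒> b≱h)) ⟩
    tri a + tri b                ≤⟨ convex a b t u b≡u+t (+-cancelʳ-≤ u t a (subst (_≤ a + u) (trans b≡u+t (+-comm u t)) (<⇒≤ (≰⇒> b≱h)))) ⟩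
    tri h′ + tri t               ≤⟨ +-monoˡ-≤ (tri t) (m≤m+n (tri h′) t) ⟩
    tri h′ + t + tri t           ≡⟨ cong (tri h′ + t +_) (packed-≤ h′ t≤h) ⟨
    tri h′ + t + packed h′ t     ≡⟨ packed-+ h′ t ⟨
    packed h′ (h′ + t)           ≡⟨ cong (λ z → packed h′ z) h+t≡a+b ⟩
    packed h′ (a + b)            ∎
    where
    h′ = a + u
    b≡u+t : b ≡ u + t
    b≡u+t = sym (+-cancelˡ-≡ a (u + t) b (trans (sym (+-assoc a u t)) h+t≡a+b))
    t≤h : t ≤ h′
    t≤h = ≤-trans (m≤n+m t u) (≤-trans (≤-reflexive (sym b≡u+t)) (<⇒≤ (≰⇒> b≱h)))
    convex : ∀ a b t u → b ≡ u + t → t ≤ a → tri a + tri b ≤ tri (a + u) + tri t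
    convex a _ t u refl t≤a with m≤n⇒∃[o]m+o≡n t≤a
    ... | q , refl = begin
      tri (t + q) + tri (u + t) ≡⟨ +-comm (tri (t + q)) _ ⟩
      tri (u + t) + tri (t + q) ≡⟨ cong (λ z → tri z + tri (t + q)) (+-comm u t) ⟩
      tri (t + u) + tri (t + q) ≤⟨ tri-convex q t u ⟩
      tri (t + q + u) + tri t   ∎

-- A column of height `suc h` is peeled off on the left and one of height `h` on the right. The odd
-- cell that remains on the right is dropped by superadditivity, and a slack of 2 is left.
packed-suc-≤ : ∀ h .{{_ : NonZero h}} n → packed (suc h) n ≤ packed h n + n
packed-suc-≤ h n = go n (<-wellFounded n)
  where
  open ≤-Reasoning
  lemma : ∀ h n a b → h + a + n + (b + n) + 2 ≡ a + suc n + b + (suc h + n)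
  lemma = solve-∀
  go : ∀ n → Acc _<_ n → packed (suc h) n ≤ packed h n + n
  go n (acc rs) with suc h ≤? n
  ... | no n≱1+h = begin
    packed (suc h) n ≡⟨ packed-< (suc h) (≰⇒> n≱1+h) ⟩
    tri n            ≡⟨ packed-≤ h (s≤s⁻¹ (≰⇒> n≱1+h)) ⟨
    packed h n       ≤⟨ m≤m+n _ n ⟩
    packed h n + n   ∎
  ... | yes 1+h≤n with m≤n⇒∃[o]m+o≡n 1+h≤n
  ...   | n′ , refl = begin
    packed (suc h) (suc h + n′)                     ≡⟨ packed-+ (suc h) n′ ⟩
    h + tri h + n′ + packed (suc h) n′              ≤⟨ +-monoʳ-≤ (h + tri h + n′) (go n′ (rs (m<n+m n′ z<s))) ⟩
    h + tri h + n′ + (packed h n′ + n′)             ≤⟨ m≤m+n _ 2 ⟩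
    h + tri h + n′ + (packed h n′ + n′) + 2         ≡⟨ lemma h n′ (tri h) (packed h n′) ⟩
    tri h + suc n′ + packed h n′ + (suc h + n′)     ≤⟨ +-monoˡ-≤ _ (+-monoʳ-≤ (tri h + suc n′) (≤-trans (m≤n+m (packed h n′) (packed h 1)) (packed-superadditive h 1 n′))) ⟩
    tri h + suc n′ + packed h (suc n′) + (suc h + n′) ≡⟨ cong (_+ (suc h + n′)) (packed-+ h (suc n′)) ⟨
    packed h (h + suc n′) + (suc h + n′)            ≡⟨ cong (λ z → packed h z + (suc h + n′)) (+-suc h n′) ⟩
    packed h (suc h + n′) + (suc h + n′)            ∎

packed-+-≤ : ∀ h .{{_ : NonZero h}} y .{{_ : NonZero (h + y)}} n → packed (h + y) n ≤ packed h n + y * n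
packed-+-≤ h@(suc h-1) zero n = ≤-reflexive (trans (aux (+-identityʳ h)) (sym (+-identityʳ _)))
  where
  -- The nonzero instance depends on the height, so the equation is matched on instead of being
  -- passed to `cong`.
  aux : ∀ {k} → k ≡ h → .{{_ : NonZero k}} → packed k n ≡ packed h n
  aux refl = refl
packed-+-≤ h@(suc h-1) (suc y) n rewrite +-suc h-1 y = begin
  packed (suc (h + y)) n   ≤⟨ packed-suc-≤ (h + y) n ⟩
  packed (h + y) n + n     ≤⟨ +-monoˡ-≤ n (packed-+-≤ h y n) ⟩
  packed h n + y * n + n   ≡⟨ lemma (packed h n) (y * n) n ⟩
  packed h n + (n + y * n) ∎
  where
  open ≤-Reasoning
  lemma : ∀ a b c → a + b + c ≡ a + (c + b)
  lemma = solve-∀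

-- The topmost cells of the last column are moved on top of the other columns.
packed-mono-suc : ∀ h .{{_ : NonZero h}} n → n ≤ h * h → packed h n ≤ packed (suc h) n
packed-mono-suc h n n≤h² =
  subst (λ z → packed h z ≤ packed (suc h) z) (sym n≡) (go h (n / h) (n % h) p≤h (m%n<n n h))
  where
  open ≤-Reasoning
  n≡ : n ≡ n / h * h + n % h
  n≡ = trans (m≡m%n+[m/n]*n n h) (+-comm (n % h) _)
  p≤h : n / h ≤ h
  p≤h = ≤-trans (/-monoˡ-≤ h n≤h²) (≤-reflexive (m*n/n≡m h h))

  e₁ : ∀ p v h → p * h + (p + v) ≡ p * suc h + v
  e₁ = solve-∀
  e₂ : ∀ p v w a b c →
       p * a + (p + v + w) * b + (b + c + p * v) + p * (p + v) + p * w ≡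
       p * (p + v + w + a) + suc (p + v + w) * b + c + p * v
  e₂ = solve-∀
  e₃ : ∀ q v z → suc (q + v) * (suc q + z + v) + q ≡ (q + v) * suc (suc q + z + v) + (suc q + z)
  e₃ = solve-∀
  e₄ : ∀ q v z a b c → let t = a + b + (suc q + z) * v; u = c + b + q * v in
       suc (q + v) * t + (suc q + z + v) * (q + v + u) + c + suc (q + v) * q + q * z ≡
       (q + v) * (suc q + z + v + t) + suc (suc q + z + v) * u + a + (q + v) * (suc q + z)
  e₄ = solve-∀

  e₅ : ∀ q v z → q + v + z ≡ q + z + v
  e₅ = solve-∀

  -- The last column has at least `p` cells: its top `p` cells go on top of the `p` full columns,
  -- and each of them gains `w`.
  many : ∀ p v w .{{_ : NonZero (p + v + w)}} → let h = p + v + w in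
         packed h (p * h + (p + v)) ≤ packed (suc h) (p * h + (p + v))
  many p v w = let h = p + v + w in begin
    packed h (p * h + (p + v))       ≡⟨ packed-*+ h p (m≤m+n (p + v) w) ⟩
    packed′ h p (p + v)              ≡⟨ cong (λ z → p * tri h + h * tri p + z + p * (p + v)) (tri-+ p v) ⟩
    p * tri h + h * tri p + (tri p + tri v + p * v) + p * (p + v)
                                     ≤⟨ m≤m+n _ (p * w) ⟩
    p * tri h + h * tri p + (tri p + tri v + p * v) + p * (p + v) + p * w
                                     ≡⟨ e₂ p v w (tri h) (tri p) (tri v) ⟩
    packed′ (suc h) p v              ≡⟨ packed-*+ (suc h) p (m≤n⇒m≤1+n (≤-trans (m≤n+m v p) (m≤m+n _ w))) ⟨
    packed (suc h) (p * suc h + v)   ≡⟨ cong (λ z → packed (suc h) z) (e₁ p v h) ⟨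
    packed (suc h) (p * h + (p + v)) ∎

  -- The last column is too short: all its `q` cells move up, each gaining `z`, and the last full
  -- column gives its top `v` cells, at no gain, to complete the new row over the other `q + v`
  -- columns.
  few : ∀ q v z → let h = suc q + z + v; p = suc (q + v) in
        packed h (p * h + q) ≤ packed (suc h) (p * h + q)
  few q v z = let h = suc q + z + v; p = suc (q + v) in begin
    packed h (p * h + q)             ≡⟨ packed-*+ h p (m≤n⇒m≤1+n (≤-trans (m≤m+n q z) (m≤m+n _ v))) ⟩
    packed′ h p q                    ≤⟨ m≤m+n _ (q * z) ⟩
    packed′ h p q + q * z            ≡⟨ cong₂ (λ t u → p * t + h * (q + v + u) + tri q + p * q + q * z)
                                              (tri-+ (suc q + z) v) (tri-+ q v) ⟩
    _                                ≡⟨ e₄ q v z (tri (suc q + z)) (tri v) (tri q) ⟩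
    _                                ≡⟨ cong₂ (λ t u → (q + v) * (h + t) + suc h * u + tri (suc q + z) + (q + v) * (suc q + z))
                                              (tri-+ (suc q + z) v) (tri-+ q v) ⟨
    packed′ (suc h) (q + v) (suc q + z)
                                     ≡⟨ packed-*+ (suc h) (q + v) (m≤n⇒m≤1+n (m≤m+n _ v)) ⟨
    packed (suc h) ((q + v) * suc h + (suc q + z))
                                     ≡⟨ cong (λ z → packed (suc h) z) (e₃ q v z) ⟨
    packed (suc h) (p * h + q)       ∎

  go : ∀ h .{{_ : NonZero h}} p q → p ≤ h → q < h → packed h (p * h + q) ≤ packed (suc h) (p * h + q)
  go h p q p≤h q<h with p ≤? q
  ... | yes p≤q with m≤n⇒∃[o]m+o≡n p≤q
  ...   | v , refl with m≤n⇒∃[o]m+o≡n (<⇒≤ q<h)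
  ...     | w , refl = many p v w
  go h p q p≤h q<h | no p≰q with m≤n⇒∃[o]m+o≡n (≰⇒> p≰q)
  ...   | v , refl with m≤n⇒∃[o]m+o≡n p≤h
  ...     | z , refl rewrite e₅ q v z = few q v z

-- Weights of diagrams

weight : List ℕ → ℕ
weight []       = 0
weight (x ∷ xs) = tri x + sum (map (x ⊓_) xs) + weight xs

-- Because of this symmetry no list ever has to be sorted: it is enough to separate the columns by a
-- threshold.
weight-↭ : ∀ {xs ys} → xs ↭ ys → weight xs ≡ weight ys
weight-↭ refl↭         = refl
weight-↭ (prep x p)    = cong₂ (λ a b → tri x + a + b) (sum-↭ (map⁺ (x ⊓_) p)) (weight-↭ p)
weight-↭ (swap {xs} {ys} x y p) = begin
  tri x + (x ⊓ y + sum (map (x ⊓_) xs)) + (tri y + sum (map (y ⊓_) xs) + weight xs)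
    ≡⟨ lemma (tri x) (tri y) (x ⊓ y) _ _ (weight xs) ⟩
  tri y + (x ⊓ y + sum (map (y ⊓_) xs)) + (tri x + sum (map (x ⊓_) xs) + weight xs)
    ≡⟨ cong₂ (λ a b → tri y + (a + b) + (tri x + sum (map (x ⊓_) xs) + weight xs)) (⊓-comm x y) (sum-↭ (map⁺ (y ⊓_) p)) ⟩
  tri y + (y ⊓ x + sum (map (y ⊓_) ys)) + (tri x + sum (map (x ⊓_) xs) + weight xs)
    ≡⟨ cong₂ (λ a b → tri y + (y ⊓ x + sum (map (y ⊓_) ys)) + (tri x + a + b)) (sum-↭ (map⁺ (x ⊓_) p)) (weight-↭ p) ⟩
  tri y + (y ⊓ x + sum (map (y ⊓_) ys)) + (tri x + sum (map (x ⊓_) ys) + weight ys)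
    ∎
  where
  open ≡-Reasoning
  lemma : ∀ a b m c d w → a + (m + c) + (b + d + w) ≡ b + (m + d) + (a + c + w)
  lemma = solve-∀
weight-↭ (trans↭ p q)  = trans (weight-↭ p) (weight-↭ q)

sum-map-⊓-≤ : ∀ {t xs} → All (_≤ t) xs → sum (map (t ⊓_) xs) ≡ sum xs
sum-map-⊓-≤ []       = refl
sum-map-⊓-≤ (p ∷ ps) = cong₂ _+_ (m≥n⇒m⊓n≡n p) (sum-map-⊓-≤ ps)

sum-map-+ : ∀ t xs → sum (map (t +_) xs) ≡ length xs * t + sum xs
sum-map-+ t []       = refl
sum-map-+ t (x ∷ xs) = trans (cong (t + x +_) (sum-map-+ t xs)) (lemma t x (length xs * t) (sum xs))
  where
  lemma : ∀ t x a b → t + x + (a + b) ≡ t + a + (x + b)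
  lemma = solve-∀

weight-∷-max : ∀ {h xs} → All (_≤ h) xs → weight (h ∷ xs) ≡ tri h + sum xs + weight xs
weight-∷-max {h} {xs} ps = cong (λ z → tri h + z + weight xs) (sum-map-⊓-≤ ps)

-- In a pair across the threshold `t` the smaller entry lies in `ys`, so each entry of `xs`
-- contributes `sum ys`.
weight-++ : ∀ {t xs ys} → All (t ≤_) xs → All (_≤ t) ys →
            weight (xs ++ ys) ≡ weight xs + weight ys + length xs * sum ys
weight-++ {ys = ys} [] qs = sym (+-identityʳ (weight ys))
weight-++ {t} {x ∷ xs} {ys} (p ∷ ps) qs = begin
  tri x + sum (map (x ⊓_) (xs ++ ys)) + weight (xs ++ ys)
    ≡⟨ cong₂ (λ a b → tri x + a + b)
             (trans (cong sum (map-++ (x ⊓_) xs ys))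
               (trans (sum-++ (map (x ⊓_) xs) _)
                 (cong (sum (map (x ⊓_) xs) +_) (sum-map-⊓-≤ (All.map (λ q → ≤-trans q p) qs)))))
             (weight-++ ps qs) ⟩
  tri x + (sum (map (x ⊓_) xs) + sum ys) + (weight xs + weight ys + length xs * sum ys)
    ≡⟨ lemma (tri x) (sum (map (x ⊓_) xs)) (sum ys) (weight xs) (weight ys) (length xs * sum ys) ⟩
  tri x + sum (map (x ⊓_) xs) + weight xs + weight ys + (sum ys + length xs * sum ys) ∎
  where
  open ≡-Reasoning
  lemma : ∀ a b c d e f → a + (b + c) + (d + e + f) ≡ a + b + d + e + (c + f)
  lemma = solve-∀

weight-replicate-0 : ∀ n → weight (replicate n 0) ≡ 0
weight-replicate-0 zero    = refl
weight-replicate-0 (suc n) = cong₂ _+_ (sum-map-0⊓ (replicate n 0)) (weight-replicate-0 n)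
  where
  sum-map-0⊓ : ∀ xs → sum (map (0 ⊓_) xs) ≡ 0
  sum-map-0⊓ []       = refl
  sum-map-0⊓ (x ∷ xs) = sum-map-0⊓ xs

sum-replicate-0 : ∀ n → sum (replicate n 0) ≡ 0
sum-replicate-0 zero    = refl
sum-replicate-0 (suc n) = sum-replicate-0 n

-- The sum of `i + j` over the cells of `t` rows and `k` columns.
rectangle : ℕ → ℕ → ℕ
rectangle t k = k * tri t + t * tri k

-- A full rectangle of height `t` is pushed under the diagram, which raises every cell by `t`.
weight-map-+ : ∀ t xs → weight (map (t +_) xs) ≡ rectangle t (length xs) + t * sum xs + weight xs
weight-map-+ t [] = lemma t
  where
  lemma : ∀ t → 0 ≡ t * 0 + t * 0 + 0
  lemma = solve-∀
weight-map-+ t (x ∷ xs) = begin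
  tri (t + x) + sum (map ((t + x) ⊓_) (map (t +_) xs)) + weight (map (t +_) xs)
    ≡⟨ cong₂ (λ a b → a + b + weight (map (t +_) xs)) (tri-+ t x) (pairs xs) ⟩
  tri t + tri x + t * x + (length xs * t + sum (map (x ⊓_) xs)) + weight (map (t +_) xs)
    ≡⟨ cong (tri t + tri x + t * x + (length xs * t + sum (map (x ⊓_) xs)) +_) (weight-map-+ t xs) ⟩
  _ ≡⟨ lemma t x (length xs) (tri t) (tri x) (tri (length xs)) (sum (map (x ⊓_) xs)) (sum xs) (weight xs) ⟩
  rectangle t (suc (length xs)) + t * (x + sum xs) + (tri x + sum (map (x ⊓_) xs) + weight xs) ∎
  where
  open ≡-Reasoning
  pairs : ∀ xs → sum (map ((t + x) ⊓_) (map (t +_) xs)) ≡ length xs * t + sum (map (x ⊓_) xs)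
  pairs []       = refl
  pairs (y ∷ ys) = trans (cong₂ _+_ (sym (+-distribˡ-⊓ t x y)) (pairs ys))
                         (arith t (x ⊓ y) (length ys * t) (sum (map (x ⊓_) ys)))
    where
    arith : ∀ t x a b → t + x + (a + b) ≡ t + a + (x + b)
    arith = solve-∀
  lemma : ∀ t x n a b c p s w →
          a + b + t * x + (n * t + p) + (n * a + t * c + t * s + w) ≡
          a + n * a + t * (n + c) + t * (x + s) + (b + p + w)
  lemma = solve-∀

unshift : ∀ {t xs} → All (t ≤_) xs → ∃ λ as → xs ≡ map (t +_) as
unshift []       = [] , refl
unshift (p ∷ ps) with m≤n⇒∃[o]m+o≡n p | unshift ps
... | a , refl | as , refl = a ∷ as , refl

∈⇒↭∷ : ∀ {x : ℕ} {xs} → x ∈ xs → ∃ λ ys → xs ↭ x ∷ ys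
∈⇒↭∷ {x} x∈xs with ∈-∃++ x∈xs
... | ys , zs , refl = ys ++ zs , shift x ys zs

∉⇒All : ∀ {x : ℕ} {xs} → ¬ x ∈ xs → All (λ y → ¬ x ≡ y) xs
∉⇒All = Allₚ.¬Any⇒All¬ _

-- Ahlswede and Katona: a diagram in an h × h square that has no full column
-- and fewer than h nonempty ones fits in a smaller square; otherwise a full
-- column or a full row is split off.
weight≤packed : ∀ h .{{_ : NonZero h}} xs → length xs ≤ h → All (_≤ h) xs →
                weight xs ≤ packed h (sum xs)
weight≤packed h xs = go (h + sum xs + length xs) h xs ≤-refl
  where
  open ≤-Reasoning
  -- `N` bounds side plus cells plus columns. Every case lowers this total: a full column or row
  -- takes cells away, an empty column takes itself away, and otherwise the side shrinks.
  go : ∀ N h .{{_ : NonZero h}} xs → h + sum xs + length xs ≤ N → length xs ≤ h → All (_≤ h) xs →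
       weight xs ≤ packed h (sum xs)
  go zero    (suc _) xs () _ _
  go (suc N) h xs N≥ len ps with h ∈? xs
  ... | yes h∈xs with ∈⇒↭∷ h∈xs
  ...   | ys , xs↭ with All-resp-↭ xs↭ ps
  ...     | _ ∷ qs = begin
    weight xs                          ≡⟨ weight-↭ xs↭ ⟩
    weight (h ∷ ys)                    ≡⟨ weight-∷-max qs ⟩
    tri h + sum ys + weight ys         ≤⟨ +-monoʳ-≤ _ (go N h ys N≥′ (≤-trans (n≤1+n _) (subst (_≤ h) (↭-length xs↭) len)) qs) ⟩
    tri h + sum ys + packed h (sum ys) ≡⟨ packed-+ h (sum ys) ⟨
    packed h (h + sum ys)              ≡⟨ cong (λ z → packed h z) (sum-↭ xs↭) ⟨
    packed h (sum xs)                  ∎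
    where
    N≥′ : h + sum ys + length ys ≤ N
    N≥′ = s≤s⁻¹ (begin
      suc (h + sum ys + length ys)     ≡⟨ +-suc _ _ ⟨
      h + sum ys + suc (length ys)     ≤⟨ +-monoˡ-≤ _ (+-monoʳ-≤ h (m≤n+m (sum ys) h)) ⟩
      h + (h + sum ys) + suc (length ys) ≡⟨ cong₂ (λ a b → h + a + b) (sum-↭ xs↭) (↭-length xs↭) ⟨
      h + sum xs + length xs           ≤⟨ N≥ ⟩
      suc N                            ∎)
  go (suc N) h xs N≥ len ps | no h∉xs with 0 ∈? xs
  ... | yes 0∈xs with ∈⇒↭∷ 0∈xs
  ...   | ys , xs↭ with All-resp-↭ xs↭ ps
  ...     | _ ∷ qs = begin
    weight xs                        ≡⟨ weight-↭ (↭-trans xs↭ (∷↭∷ʳ 0 ys)) ⟩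
    weight (ys ++ 0 ∷ [])            ≡⟨ weight-++ {xs = ys} (All.tabulate (λ _ → z≤n)) (z≤n ∷ []) ⟩
    weight ys + 0 + length ys * 0    ≡⟨ lemma (weight ys) (length ys) ⟩
    weight ys                        ≤⟨ go N h ys N≥′ (≤-trans (n≤1+n _) (subst (_≤ h) (↭-length xs↭) len)) qs ⟩
    packed h (sum ys)                ≡⟨ cong (λ z → packed h z) (sum-↭ xs↭) ⟨
    packed h (sum xs)                ∎
    where
    lemma : ∀ a b → a + 0 + b * 0 ≡ a
    lemma = solve-∀
    N≥′ : h + sum ys + length ys ≤ N
    N≥′ = s≤s⁻¹ (begin
      suc (h + sum ys + length ys)     ≡⟨ +-suc _ _ ⟨
      h + sum ys + suc (length ys)     ≡⟨ cong₂ (λ a b → h + a + b) (sum-↭ xs↭) (↭-length xs↭) ⟨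
      h + sum xs + length xs           ≤⟨ N≥ ⟩
      suc N                            ∎)
  go (suc N) h xs N≥ len ps | no h∉xs | no 0∉xs with m≤n⇒m<n∨m≡n len
  -- All `h` columns are nonempty, so the bottom row is full. Taking it off is the mirror image of
  -- taking off a full column.
  ... | inj₂ refl with unshift (All.map (λ 0≢x → n≢0⇒n>0 (λ x≡0 → 0≢x (sym x≡0))) (∉⇒All 0∉xs))
  ...   | ys , refl = begin
    weight (map suc ys)                ≡⟨ weight-map-+ 1 ys ⟩
    rectangle 1 (length ys) + 1 * sum ys + weight ys
                                       ≡⟨ cong (_+ weight ys) (lemma (length ys) (tri (length ys)) (sum ys)) ⟩
    tri (length ys) + sum ys + weight ys
                                       ≡⟨ cong (λ z → tri z + sum ys + weight ys) (length-map suc ys) ⟨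
    tri h + sum ys + weight ys         ≤⟨ +-monoʳ-≤ _ (go N h ys N≥′ (≤-reflexive (sym (length-map suc ys))) (All.map (≤-trans (n≤1+n _)) (Allₚ.map⁻ ps))) ⟩
    tri h + sum ys + packed h (sum ys) ≡⟨ packed-+ h (sum ys) ⟨
    packed h (h + sum ys)              ≡⟨ cong (λ z → packed h z) sum≡ ⟨
    packed h (sum (map suc ys))        ∎
    where
    sum≡ : sum (map suc ys) ≡ h + sum ys
    sum≡ = trans (sum-map-+ 1 ys) (cong (_+ sum ys) (trans (*-identityʳ _) (sym (length-map suc ys))))
    lemma : ∀ n t s → n * 0 + 1 * t + 1 * s ≡ t + s
    lemma = solve-∀
    N≥′ : h + sum ys + length ys ≤ N
    N≥′ = s≤s⁻¹ (begin
      suc (h + sum ys + length ys)       ≤⟨ +-monoˡ-≤ (length ys) (+-monoʳ-< h (m<n+m (sum ys) (>-nonZero⁻¹ h))) ⟩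
      h + (h + sum ys) + length ys       ≡⟨ cong₂ (λ a b → h + a + b) sum≡ (length-map suc ys) ⟨
      h + sum (map suc ys) + length (map suc ys) ≤⟨ N≥ ⟩
      suc N                            ∎)
  -- A square of side 1 cannot shrink further, but fewer than one column is left.
  go (suc N) (suc zero) [] N≥ len ps | no h∉xs | no 0∉xs | inj₁ len<h = z≤n
  go (suc N) (suc zero) (x ∷ xs) N≥ len ps | no h∉xs | no 0∉xs | inj₁ (s≤s ())
  go (suc N) (suc h@(suc _)) xs N≥ len ps | no h∉xs | no 0∉xs | inj₁ len<h = begin
    weight xs                 ≤⟨ go N h xs (s≤s⁻¹ N≥) (s≤s⁻¹ len<h) qs ⟩
    -- Fewer than `suc h` columns of height at most `h` hold at most `h * h` cells, as the
    -- comparison of the two sides demands.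
    packed h (sum xs)         ≤⟨ packed-mono-suc h (sum xs) (≤-trans (sum≤ qs) (*-monoˡ-≤ h (s≤s⁻¹ len<h))) ⟩
    packed (suc h) (sum xs)   ∎
    where
    sum≤ : ∀ {xs} → All (_≤ h) xs → sum xs ≤ length xs * h
    sum≤ []       = z≤n
    sum≤ (q ∷ qs) = +-mono-≤ q (sum≤ qs)
    qs : All (_≤ h) xs
    qs = All.zipWith (λ (p , h≢x) → s≤s⁻¹ (≤∧≢⇒< p (λ x≡h → h≢x (sym x≡h)))) (ps , ∉⇒All h∉xs)

-- Diagrams with k high columns

extractMin : ∀ x xs → ∃₂ λ t ts → x ∷ xs ↭ t ∷ ts × All (t ≤_) ts
extractMin x []       = x , [] , ↭-refl , []
extractMin x (y ∷ xs) with extractMin y xs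
... | t , ts , p , t≤ with ≤-total x t
...   | inj₁ x≤t = x , y ∷ xs , ↭-refl ,
                   All-resp-↭ (↭-sym p) (x≤t ∷ All.map (≤-trans x≤t) t≤)
...   | inj₂ t≤x = t , x ∷ ts , ↭-trans (prep x p) (swap x t ↭-refl) , t≤x ∷ t≤

-- Selects as many of the largest entries as `x ∷ xs` has, by feeding in `ys` one at a time. An
-- entry above the threshold `t` displaces it into `us`, and the least entry of the new front
-- becomes the threshold. It never decreases, so it stays at least `ℓ`.
separate : ∀ {ℓ} x xs ys → All (ℓ ≤_) (x ∷ xs) →
           ∃ λ t → ∃₂ λ ts us → x ∷ xs ++ ys ↭ t ∷ ts ++ us × length ts ≡ length xs ×
           ℓ ≤ t × All (t ≤_) ts × All (_≤ t) us
separate x xs [] ps with extractMin x xs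
... | t , ts , p , t≤ =
  t , ts , [] , ++⁺ʳ [] p , suc-injective (↭-length (↭-sym p)) , All.head (All-resp-↭ p ps) , t≤ , []
separate x xs (y ∷ ys) ps with separate x xs ys ps
... | t , ts , us , p , len , ℓ≤t , t≤ts , us≤t with ≤-total y t
...   | inj₁ y≤t = t , ts , y ∷ us , perm , len , ℓ≤t , t≤ts , y≤t ∷ us≤t
  where
  perm : x ∷ xs ++ y ∷ ys ↭ t ∷ ts ++ y ∷ us
  perm = ↭-trans (shift y (x ∷ xs) ys) (↭-trans (prep y p) (↭-sym (shift y (t ∷ ts) us)))
...   | inj₂ t≤y with extractMin y ts
...     | t′ , ts′ , p′ , t′≤ =
  t′ , ts′ , t ∷ us , perm , trans (suc-injective (↭-length (↭-sym p′))) len , ≤-trans ℓ≤t t≤t′ ,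
  t′≤ , t≤t′ ∷ All.map (λ u≤t → ≤-trans u≤t t≤t′) us≤t
  where
  t≤t′ : t ≤ t′
  t≤t′ = All.head (All-resp-↭ p′ (t≤y ∷ t≤ts))
  perm : x ∷ xs ++ y ∷ ys ↭ t′ ∷ ts′ ++ t ∷ us
  perm = ↭-trans (shift y (x ∷ xs) ys) (↭-trans (prep y p)
         (↭-trans (swap y t ↭-refl) (↭-trans (prep t (++⁺ʳ us p′)) (↭-sym (shift t (t′ ∷ ts′) us)))))

-- A column of height q follows p full ones; whatever does not fit into k columns is dropped.
heights : (p q x k : ℕ) → List ℕ
heights p       q x zero    = []
heights zero    q x (suc k) = q ∷ replicate k 0
heights (suc p) q x (suc k) = x ∷ heights p q x k

length-heights : ∀ p q x k → length (heights p q x k) ≡ k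
length-heights p       q x zero    = refl
length-heights zero    q x (suc k) = cong suc (length-replicate k)
length-heights (suc p) q x (suc k) = cong suc (length-heights p q x k)

heights-≤ : ∀ p {q x} k → q ≤ x → All (_≤ x) (heights p q x k)
heights-≤ p       zero    q≤x = []
heights-≤ zero    (suc k) q≤x = q≤x ∷ Allₚ.replicate⁺ k z≤n
heights-≤ (suc p) (suc k) q≤x = ≤-refl ∷ heights-≤ p k q≤x

sum-heights : ∀ p q x k → p * x + q ≤ k * x → sum (heights p q x k) ≡ p * x + q
sum-heights p       q x zero    le = sym (n≤0⇒n≡0 le)
sum-heights zero    q x (suc k) le = trans (cong (q +_) (sum-replicate-0 k)) (+-identityʳ q)
sum-heights (suc p) q x (suc k) le =
  trans (cong (x +_) (sum-heights p q x k (+-cancelˡ-≤ x _ _ (subst (_≤ x + k * x) (+-assoc x (p * x) q) le))))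
        (sym (+-assoc x (p * x) q))

weight-heights : ∀ p q x k .{{_ : NonZero x}} → q ≤ x → p * x + q ≤ k * x →
                 weight (heights p q x k) ≡ packed x (p * x + q)
weight-heights p q x zero q≤x le rewrite n≤0⇒n≡0 le = sym (packed-≤ x z≤n)
weight-heights zero q x (suc k) q≤x le = begin
  weight (q ∷ replicate k 0)                           ≡⟨ weight-∷-max (Allₚ.replicate⁺ k z≤n) ⟩
  tri q + sum (replicate k 0) + weight (replicate k 0) ≡⟨ cong₂ (λ a b → tri q + a + b) (sum-replicate-0 k) (weight-replicate-0 k) ⟩
  tri q + 0 + 0                                        ≡⟨ trans (+-identityʳ _) (+-identityʳ _) ⟩
  tri q                                                ≡⟨ packed-≤ x q≤x ⟨
  packed x q                                           ∎
  where open ≡-Reasoning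
weight-heights (suc p) q x (suc k) q≤x le = begin
  weight (x ∷ heights p q x k)                              ≡⟨ weight-∷-max (heights-≤ p k q≤x) ⟩
  tri x + sum (heights p q x k) + weight (heights p q x k)  ≡⟨ cong₂ (λ a b → tri x + a + b) (sum-heights p q x k le′) (weight-heights p q x k q≤x le′) ⟩
  tri x + (p * x + q) + packed x (p * x + q)                ≡⟨ packed-+ x (p * x + q) ⟨
  packed x (x + (p * x + q))                                ≡⟨ cong (λ z → packed x z) (+-assoc x (p * x) q) ⟨
  packed x (x + p * x + q)                                  ∎
  where
  open ≡-Reasoning
  le′ : p * x + q ≤ k * x
  le′ = +-cancelˡ-≤ x _ _ (subst (_≤ x + k * x) (+-assoc x (p * x) q) le)

map-+-+ : ∀ s t xs → map (s + t +_) xs ≡ map (s +_) (map (t +_) xs)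
map-+-+ s t xs = trans (map-cong (+-assoc s t) xs) (map-∘ xs)

-- `heights q 0 1 k` is a row of `q` cells, so this is the transpose of packed columns: `p` full
-- rows of length `k` and a partial one. The sum of `i + j` does not change under transposition.
weight-rows : ∀ p q k .{{_ : NonZero k}} → q ≤ k →
              weight (map (p +_) (heights q 0 1 k)) ≡ packed k (p * k + q)
weight-rows p q k q≤k = begin
  weight (map (p +_) hs)                          ≡⟨ weight-map-+ p hs ⟩
  rectangle p (length hs) + p * sum hs + weight hs ≡⟨ cong₂ (λ a b → rectangle p a + p * b + weight hs) (length-heights q 0 1 k) (sum-heights q 0 1 k le) ⟩
  rectangle p k + p * (q * 1 + 0) + weight hs     ≡⟨ cong (rectangle p k + p * (q * 1 + 0) +_) (trans (weight-heights q 0 1 k z≤n le) (packed-*+ 1 q z≤n)) ⟩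
  rectangle p k + p * (q * 1 + 0) + packed′ 1 q 0 ≡⟨ lemma k p q (tri k) (tri p) (tri q) ⟩
  packed′ k p q                                   ≡⟨ packed-*+ k p q≤k ⟨
  packed k (p * k + q)                            ∎
  where
  open ≡-Reasoning
  hs = heights q 0 1 k
  le : q * 1 + 0 ≤ k * 1
  le = subst₂ _≤_ (sym (trans (+-identityʳ _) (*-identityʳ q))) (sym (*-identityʳ k)) q≤k
  lemma : ∀ k p q a b c → k * b + p * a + p * (q * 1 + 0) + (q * 0 + 1 * c + 0 + q * 0) ≡ p * a + k * b + c + p * q
  lemma = solve-∀

sum-rows : ∀ p q k → q ≤ k → sum (map (p +_) (heights q 0 1 k)) ≡ p * k + q
sum-rows p q k q≤k = trans (sum-map-+ p (heights q 0 1 k))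
  (cong₂ _+_ (trans (cong (_* p) (length-heights q 0 1 k)) (*-comm k p))
             (trans (sum-heights q 0 1 k (subst₂ _≤_ (sym e) (sym (*-identityʳ k)) q≤k)) e))
  where
  e : q * 1 + 0 ≡ q
  e = trans (+-identityʳ _) (*-identityʳ q)

rows-≤ : ∀ p q x k .{{_ : NonZero k}} → p * k + q ≤ x * k → All (_≤ x) (map (p +_) (heights q 0 1 k))
rows-≤ p zero x k le = Allₚ.map⁺ (All.map (λ { z≤n → subst (_≤ x) (sym (+-identityʳ p)) p≤x }) (zeros k))
  where
  p≤x : p ≤ x
  p≤x = *-cancelʳ-≤ p x k (≤-trans (m≤m+n _ 0) le)
  zeros : ∀ k → All (_≤ 0) (heights 0 0 1 k)
  zeros zero    = []
  zeros (suc k) = z≤n ∷ Allₚ.replicate⁺ k z≤n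
-- A nonempty last row is row `p`, counted from zero, so `p < x` has to hold; for an empty one
-- `p ≤ x` was enough.
rows-≤ p (suc q) x k le = Allₚ.map⁺ (All.map (λ h≤1 → ≤-trans (+-monoʳ-≤ p h≤1) (subst (_≤ x) (+-comm 1 p) p<x)) (heights-≤ (suc q) k z≤n))
  where
  p<x : p < x
  p<x = *-cancelʳ-< k p x (<-≤-trans (m<m+n (p * k) z<s) le)

-- A diagram in a box of `x` rows and `k` columns that attains the bound for a square around the
-- box.
record Optimal (x k n : ℕ) : Set where
  field
    side           : ℕ
    {{side≢0}}     : NonZero side
    k≤side         : k ≤ side
    x≤side         : x ≤ side
    columns        : List ℕ
    columns-≤      : All (_≤ x) columns
    length-columns : length columns ≡ k
    sum-columns    : sum columns ≡ n
    weight-columns : weight columns ≡ packed side n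

-- The cells are packed along the longer dimension of the box, in columns or in rows, and that
-- dimension is the side of the square.
optimal : ∀ x k n .{{_ : NonZero k}} → n ≤ k * x → Optimal x k n
optimal x k n n≤kx with ≤-total k x
... | inj₁ k≤x = record
  { side           = x
  ; side≢0         = nz
  ; k≤side         = k≤x
  ; x≤side         = ≤-refl
  ; columns        = heights (n / x) (n % x) x k
  ; columns-≤      = heights-≤ (n / x) k (<⇒≤ (m%n<n n x))
  ; length-columns = length-heights (n / x) (n % x) x k
  ; sum-columns    = trans (sum-heights (n / x) (n % x) x k le) n≡
  ; weight-columns = trans (weight-heights (n / x) (n % x) x k (<⇒≤ (m%n<n n x)) le) (cong (λ z → packed x z) n≡)
  }
  where
  instance
    nz : NonZero x
    nz = >-nonZero (≤-trans (>-nonZero⁻¹ k) k≤x)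
  n≡ : n / x * x + n % x ≡ n
  n≡ = trans (+-comm _ (n % x)) (sym (m≡m%n+[m/n]*n n x))
  le : n / x * x + n % x ≤ k * x
  le = subst (_≤ k * x) (sym n≡) n≤kx
... | inj₂ x≤k = record
  { side           = k
  ; side≢0         = >-nonZero (>-nonZero⁻¹ k)
  ; k≤side         = ≤-refl
  ; x≤side         = x≤k
  ; columns        = map (n / k +_) (heights (n % k) 0 1 k)
  ; columns-≤      = rows-≤ (n / k) (n % k) x k (subst₂ _≤_ (sym n≡) (*-comm k x) n≤kx)
  ; length-columns = trans (length-map _ (heights (n % k) 0 1 k)) (length-heights (n % k) 0 1 k)
  ; sum-columns    = trans (sum-rows (n / k) (n % k) k q≤k) n≡
  ; weight-columns = trans (weight-rows (n / k) (n % k) k q≤k) (cong (λ z → packed k z) n≡)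
  }
  where
  n≡ : n / k * k + n % k ≡ n
  n≡ = trans (+-comm _ (n % k)) (sym (m≡m%n+[m/n]*n n k))
  q≤k : n % k ≤ k
  q≤k = <⇒≤ (m%n<n n k)

-- Trading the cells right of the rectangle for cells above it

weight-lift-≤ : ∀ h .{{_ : NonZero h}} t as → length as ≤ h → All (_≤ h) as →
                weight (map (t +_) as) ≤ rectangle t (length as) + t * sum as + packed h (sum as)
weight-lift-≤ h t as len ps = ≤-trans (≤-reflexive (weight-map-+ t as)) (+-monoʳ-≤ _ (weight≤packed h as len ps))

-- The cells right of the first k columns fit in a square of side y more than
-- the side of the square above them; this costs y per cell, which is what the
-- cells gain by being moved from behind k columns to above k + y rows.
weight-separated-≤ : ∀ h y .{{_ : NonZero h}} as us → let k = length as; t = k + y; n = sum as + sum us in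
  k ≤ h → All (_≤ h) as → length us ≤ h + y → All (_≤ t) us →
  weight (map (t +_) as ++ us) ≤ rectangle t k + t * n + packed h n
weight-separated-≤ h y as us k≤h as≤ len us≤ = begin
  weight (map (t +_) as ++ us)
    ≡⟨ weight-++ {t} {map (t +_) as} (Allₚ.map⁺ (All.tabulate (λ {a} _ → m≤m+n t a))) us≤ ⟩
  weight (map (t +_) as) + weight us + length (map (t +_) as) * b
    ≡⟨ cong (λ z → weight (map (t +_) as) + weight us + z * b) (length-map (t +_) as) ⟩
  weight (map (t +_) as) + weight us + k * b
    ≤⟨ +-monoˡ-≤ (k * b) (+-mono-≤ (weight-lift-≤ h t as k≤h as≤)
         (≤-trans (weight≤packed (h + y) us len (All.map (λ u≤t → ≤-trans u≤t (+-monoˡ-≤ y k≤h)) us≤)) (packed-+-≤ h y b))) ⟩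
  rectangle t k + t * a + packed h a + (packed h b + y * b) + k * b
    ≡⟨ lemma k y a b (rectangle t k) (packed h a) (packed h b) ⟩
  rectangle t k + t * (a + b) + (packed h a + packed h b)
    ≤⟨ +-monoʳ-≤ (rectangle t k + t * (a + b)) (packed-superadditive h a b) ⟩
  rectangle t k + t * (a + b) + packed h (a + b) ∎
  where
  open ≤-Reasoning
  k = length as
  t = k + y
  a = sum as
  b = sum us
  instance
    nz : NonZero (h + y)
    nz = >-nonZero (≤-trans (>-nonZero⁻¹ h) (m≤m+n h y))
  lemma : ∀ k y a b r c d → r + (k + y) * a + c + (d + y * b) + k * b ≡ r + (k + y) * (a + b) + (c + d)
  lemma = solve-∀

module _ (ℓ z x k : ℕ) .{{_ : NonZero k}} where

  -- The bound is applied twice. Above row `t = ℓ + z` it leaves `packed side n′`; `optimal`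
  -- realises this value by a diagram in the first `k` columns, which is then cut at the lower row
  -- `ℓ` and bounded again, now in a square of side `h`.
  weight-lifted-≤ : ∀ h y n .{{_ : NonZero h}} as us → k ≤ h → z + x ≤ h → ℓ + z ≡ k + y → length as ≡ k →
    k + length us ≤ ℓ + (z + x) → n ≤ k * (z + x) → All (_≤ x) as → All (_≤ ℓ + z) us →
    sum (map (ℓ + z +_) as ++ us) ≡ k * ℓ + n →
    weight (map (ℓ + z +_) as ++ us) ≤ rectangle ℓ k + ℓ * n + packed h n
  weight-lifted-≤ h y n as us k≤h z+x≤h t≡ refl size n≤ as≤ us≤ sum≡ = begin
    weight (map (t +_) as ++ us)
      ≡⟨ cong (λ z → weight (map (z +_) as ++ us)) t≡ ⟩
    weight (map (k + y +_) as ++ us)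
      ≤⟨ weight-separated-≤ side y as us k≤side (All.map (λ a≤x → ≤-trans a≤x x≤side) as≤) len
           (subst (λ z → All (_≤ z) us) t≡ us≤) ⟩
    rectangle (k + y) k + (k + y) * n′ + packed side n′
      ≡⟨ cong₂ (λ t w → rectangle t k + t * n′ + w) (sym t≡) (sym weight-columns) ⟩
    rectangle t k + t * n′ + weight columns
      ≡⟨ cong₂ (λ a b → rectangle t a + t * b + weight columns) length-columns sum-columns ⟨
    rectangle t (length columns) + t * sum columns + weight columns
      ≡⟨ weight-map-+ t columns ⟨
    weight (map (t +_) columns)
      ≡⟨ cong weight (map-+-+ ℓ z columns) ⟩
    weight (map (ℓ +_) columns′)
      ≤⟨ weight-lift-≤ h ℓ columns′ (subst (_≤ h) (sym length-columns′) k≤h)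
           (Allₚ.map⁺ (All.map (λ c≤x → ≤-trans (+-monoʳ-≤ z c≤x) z+x≤h) columns-≤)) ⟩
    rectangle ℓ (length columns′) + ℓ * sum columns′ + packed h (sum columns′)
      ≡⟨ cong₂ (λ a b → rectangle ℓ a + ℓ * b + packed h b) length-columns′ sum-columns′ ⟩
    rectangle ℓ k + ℓ * n + packed h n ∎
    where
    open ≤-Reasoning
    t  = ℓ + z
    n′ = sum as + sum us
    arith : ∀ k ℓ z a b → k * ℓ + (k * z + (a + b)) ≡ k * (ℓ + z) + a + b
    arith = solve-∀
    -- Of the `n` cells beyond the `k * ℓ` ones, `k * z` extend the rectangle from row `ℓ` up to row
    -- `t`.
    n≡ : k * z + n′ ≡ n
    n≡ = +-cancelˡ-≡ (k * ℓ) _ _ (begin-equality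
      k * ℓ + (k * z + n′)               ≡⟨ arith k ℓ z (sum as) (sum us) ⟩
      k * t + sum as + sum us            ≡⟨ cong (_+ sum us) (sum-map-+ t as) ⟨
      sum (map (t +_) as) + sum us       ≡⟨ sum-++ (map (t +_) as) us ⟨
      sum (map (t +_) as ++ us)          ≡⟨ sum≡ ⟩
      k * ℓ + n                          ∎)
    -- All cells outside the taller rectangle find room in the `x` rows above it.
    n′≤ : n′ ≤ k * x
    n′≤ = +-cancelˡ-≤ (k * z) _ _ (subst₂ _≤_ (sym n≡) (*-distribˡ-+ k z x) n≤)
    open Optimal (optimal x k n′ n′≤)
    instance
      nz : NonZero side
      nz = side≢0
    columns′ = map (z +_) columns
    length-columns′ : length columns′ ≡ k
    length-columns′ = trans (length-map (z +_) columns) length-columns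
    sum-columns′ : sum columns′ ≡ n
    sum-columns′ = trans (sum-map-+ z columns) (trans (cong₂ (λ a b → a * z + b) length-columns sum-columns) n≡)
    -- There are at most as many columns as rows, of which there are `k + y + x`; this is how
    -- `s ≤ r` enters.
    len : length us ≤ side + y
    len = +-cancelˡ-≤ k _ _ (begin
      k + length us    ≤⟨ size ⟩
      ℓ + (z + x)      ≡⟨ +-assoc ℓ z x ⟨
      ℓ + z + x        ≡⟨ cong (_+ x) t≡ ⟩
      k + y + x        ≤⟨ +-monoʳ-≤ (k + y) x≤side ⟩
      k + y + side     ≡⟨ trans (+-assoc k y side) (cong (k +_) (+-comm y side)) ⟩
      k + (side + y)   ∎)

-- The columns of `xs` may not be the largest ones; `separate` exchanges them for those, with least
-- height `t = ℓ + z`. The side `h` stays open, since `B₁` and `B₂` call for different ones.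
weight-tall-≤ : ∀ h .{{_ : NonZero h}} ℓ x n xs ys → let k = length xs in
  .{{_ : NonZero k}} → k ≤ h → x ≤ h → k ≤ ℓ → k + length ys ≤ ℓ + x → n ≤ k * x →
  All (ℓ ≤_) xs → All (_≤ ℓ + x) (xs ++ ys) → sum (xs ++ ys) ≡ k * ℓ + n →
  weight (xs ++ ys) ≤ rectangle ℓ k + ℓ * n + packed h n
weight-tall-≤ h ℓ x n (x₀ ∷ xs) ys k≤h x≤h k≤ℓ size n≤kx ℓ≤ ≤r sum≡
  with separate x₀ xs ys ℓ≤
... | t , ts , us , perm , len , ℓ≤t , t≤ts , us≤t
  with All-resp-↭ perm ≤r | m≤n⇒∃[o]m+o≡n ℓ≤t
... | tus≤r@(t≤r ∷ _) | z , refl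
  -- The `x′` rows above row `t` come from `t ≤ ℓ + x`, and `y` comes from `k ≤ ℓ ≤ t`.
  with m≤n⇒∃[o]m+o≡n (+-cancelˡ-≤ ℓ z x t≤r) | m≤n⇒∃[o]m+o≡n (≤-trans k≤ℓ ℓ≤t) | unshift (≤-refl ∷ t≤ts)
... | x′ , refl | y , t≡ | as , tts≡ = begin
  weight (x₀ ∷ xs ++ ys)            ≡⟨ weight-↭ perm ⟩
  weight ((t ∷ ts) ++ us)           ≡⟨ cong (λ z → weight (z ++ us)) tts≡ ⟩
  weight (map (ℓ + z +_) as ++ us)
    ≤⟨ weight-lifted-≤ ℓ z x′ k h y n as us k≤h x≤h (sym t≡) length-as (subst (λ j → k + j ≤ _) length-us size) n≤kx as≤
         us≤t (trans (cong (λ z → sum (z ++ us)) (sym tts≡)) (trans (sym (sum-↭ perm)) sum≡)) ⟩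
  rectangle ℓ k + ℓ * n + packed h n ∎
  where
  open ≤-Reasoning
  k = length (x₀ ∷ xs)
  length-as : length as ≡ k
  length-as = trans (sym (length-map (ℓ + z +_) as)) (trans (cong length (sym tts≡)) (cong suc len))
  length-us : length ys ≡ length us
  length-us = +-cancelˡ-≡ k _ _ (begin-equality
    k + length ys                ≡⟨ length-++ (x₀ ∷ xs) ⟨
    length (x₀ ∷ xs ++ ys)       ≡⟨ ↭-length perm ⟩
    length (t ∷ ts ++ us)        ≡⟨ length-++ (t ∷ ts) ⟩
    suc (length ts) + length us  ≡⟨ cong (λ j → suc j + length us) len ⟩
    k + length us                ∎)
  as≤ : All (_≤ x′) as
  as≤ = All.map (λ {a} p → +-cancelˡ-≤ (ℓ + z) a x′ (subst (ℓ + z + a ≤_) (sym (+-assoc ℓ z x′)) p))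
          (Allₚ.map⁻ (proj₁ (Allₚ.++⁻ (map (ℓ + z +_) as) (subst (λ l → All (_≤ ℓ + (z + x′)) (l ++ us)) tts≡ tus≤r))))

-- Bipartite graphs

indicator : Bool → ℕ
indicator true  = 1
indicator false = 0

∣tabulate∣ : ∀ {n} (f : Fin n → Bool) → ∣ Vec.tabulate f ∣ ≡ ∑ (indicator ∘ f)
∣tabulate∣ {zero}  f = refl
∣tabulate∣ {suc n} f with f fzero
... | true  = cong suc (∣tabulate∣ (f ∘ fsuc))
... | false = ∣tabulate∣ (f ∘ fsuc)

∑-mono : ∀ {n} {f g : Fin n → ℕ} → (∀ i → f i ≤ g i) → ∑ f ≤ ∑ g
∑-mono {zero}  f≤g = z≤n
∑-mono {suc n} f≤g = +-mono-≤ (f≤g fzero) (∑-mono (f≤g ∘ fsuc))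

∑-zero : ∀ n → ∑ {n} (λ _ → 0) ≡ 0
∑-zero zero    = refl
∑-zero (suc n) = ∑-zero n

sum-tabulate : ∀ {n} (f : Fin n → ℕ) → sum (tabulate f) ≡ ∑ f
sum-tabulate {zero}  f = refl
sum-tabulate {suc n} f = cong (f fzero +_) (sum-tabulate (f ∘ fsuc))

sum-map-tabulate : ∀ {n} (g : ℕ → ℕ) (f : Fin n → ℕ) → sum (map g (tabulate f)) ≡ ∑ (g ∘ f)
sum-map-tabulate {zero}  g f = refl
sum-map-tabulate {suc n} g f = cong (g (f fzero) +_) (sum-map-tabulate g (f ∘ fsuc))

∑-indicator-≤ : ∀ {n} (f : Fin n → Bool) → ∑ (indicator ∘ f) ≤ n
∑-indicator-≤ {zero}  f = z≤n
∑-indicator-≤ {suc n} f with f fzero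
... | true  = s≤s (∑-indicator-≤ (f ∘ fsuc))
... | false = m≤n⇒m≤1+n (∑-indicator-≤ (f ∘ fsuc))

common : ∀ {n} → (Fin n → Bool) → (Fin n → Bool) → ℕ
common a b = ∑ λ u → indicator (a u ∧ b u)

common-≤-⊓ : ∀ {n} (a b : Fin n → Bool) → common a b ≤ ∑ (indicator ∘ a) ⊓ ∑ (indicator ∘ b)
common-≤-⊓ a b = ⊓-glb (∑-mono (λ u → left (a u) (b u))) (∑-mono (λ u → right (a u) (b u)))
  where
  left : ∀ x y → indicator (x ∧ y) ≤ indicator x
  left true  true  = ≤-refl
  left true  false = z≤n
  left false y     = z≤n
  right : ∀ x y → indicator (x ∧ y) ≤ indicator y
  right true  y = ≤-refl
  right false y = z≤n

weight-tabulate-suc : ∀ {s} (c : Fin (suc s) → ℕ) →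
  weight (tabulate c) ≡ tri (c fzero) + ∑ (λ w → c fzero ⊓ c (fsuc w)) + weight (tabulate (c ∘ fsuc))
weight-tabulate-suc c = cong (λ z → tri (c fzero) + z + weight (tabulate (c ∘ fsuc)))
                             (sum-map-tabulate (c fzero ⊓_) (c ∘ fsuc))

rearrange : ∀ a b c d → a + b + (c + d) ≡ c + a + (b + d)
rearrange = solve-∀

module _ {r : ℕ} where

  column : ∀ {s} → BipartiteGraph r s → Fin s → Fin r → Bool
  column G w u = G u w

  colDegrees : ∀ {s} → BipartiteGraph r s → Fin s → ℕ
  colDegrees G w = degree G (inj₂ w)

  dropColumn : ∀ {s} → BipartiteGraph r (suc s) → BipartiteGraph r s
  dropColumn G u w = G u (fsuc w)

  centredAtU : ∀ {s} → BipartiteGraph r s → ℕ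
  centredAtU G = ∑ λ u → tri (∑ λ w → indicator (G u w))

  -- A copy of `S₂` centred in `U` with one end at the first vertex of `W` is a common neighbour of
  -- that vertex and another one; interchanging the sums collects these copies by their other end.
  centredAtU-suc : ∀ {s} (G : BipartiteGraph r (suc s)) →
    centredAtU G ≡ ∑ (λ w → common (column G fzero) (column G (fsuc w))) + centredAtU (dropColumn G)
  centredAtU-suc G = begin
    ∑ (λ u → tri (indicator (G u fzero) + rest u))
      ≡⟨ ∑ₚ.sum-cong-≗ (λ u → trans (bit (G u fzero) (rest u)) (cong (_+ tri (rest u)) (∧-∑ (G u fzero) (λ w → G u (fsuc w))))) ⟩
    ∑ (λ u → ∑ (λ w → indicator (G u fzero ∧ G u (fsuc w))) + tri (rest u))
      ≡⟨ ∑ₚ.∑-distrib-+ (λ u → ∑ (λ w → indicator (G u fzero ∧ G u (fsuc w)))) (λ u → tri (rest u)) ⟩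
    ∑ (λ u → ∑ (λ w → indicator (G u fzero ∧ G u (fsuc w)))) + centredAtU (dropColumn G)
      ≡⟨ cong (_+ centredAtU (dropColumn G)) (∑ₚ.∑-comm (λ u w → indicator (G u fzero ∧ G u (fsuc w)))) ⟩
    ∑ (λ w → common (column G fzero) (column G (fsuc w))) + centredAtU (dropColumn G) ∎
    where
    open ≡-Reasoning
    rest : Fin r → ℕ
    rest u = ∑ λ w → indicator (G u (fsuc w))
    bit : ∀ b d → tri (indicator b + d) ≡ indicator b * d + tri d
    bit true  d = cong (_+ tri d) (sym (+-identityʳ d))
    bit false d = refl
    ∧-∑ : ∀ {n} b (f : Fin n → Bool) → indicator b * ∑ (indicator ∘ f) ≡ ∑ (λ w → indicator (b ∧ f w))
    ∧-∑ true  f = +-identityʳ _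
    ∧-∑ {n} false f = sym (∑-zero n)

  N-S₂≡ : ∀ {s} (G : BipartiteGraph r s) → N-S₂ G ≡ centredAtU G + ∑ (tri ∘ colDegrees G)
  N-S₂≡ G = cong₂ _+_
    (∑ₚ.sum-cong-≗ (λ u → trans (nC2≡tri (degree G (inj₁ u))) (cong tri (∣tabulate∣ (G u)))))
    (∑ₚ.sum-cong-≗ (λ w → nC2≡tri (colDegrees G w)))

  -- Copies centred in `U` are counted by their pair of ends in `W`, whose common neighbours are at
  -- most as many as the smaller degree.
  N-S₂≤weight : ∀ {s} (G : BipartiteGraph r s) → N-S₂ G ≤ weight (tabulate (colDegrees G))
  N-S₂≤weight G = ≤-trans (≤-reflexive (N-S₂≡ G)) (go G)
    where
    open ≤-Reasoning
    go : ∀ {s} (G : BipartiteGraph r s) → centredAtU G + ∑ (tri ∘ colDegrees G) ≤ weight (tabulate (colDegrees G))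
    go {zero}  G = ≤-reflexive (trans (+-identityʳ _) (∑-zero r))
    go {suc s} G = begin
      centredAtU G + (tri (c fzero) + ∑ (tri ∘ c ∘ fsuc))
        ≡⟨ cong (_+ (tri (c fzero) + ∑ (tri ∘ c ∘ fsuc))) (centredAtU-suc G) ⟩
      ∑ shared + centredAtU G′ + (tri (c fzero) + ∑ (tri ∘ c ∘ fsuc))
        ≡⟨ rearrange (∑ shared) _ (tri (c fzero)) _ ⟩
      tri (c fzero) + ∑ shared + (centredAtU G′ + ∑ (tri ∘ c ∘ fsuc))
        ≤⟨ +-mono-≤ (+-monoʳ-≤ (tri (c fzero)) (∑-mono λ w → subst₂ (λ a b → shared w ≤ a ⊓ b)
             (sym (∣tabulate∣ (column G fzero))) (sym (∣tabulate∣ (column G (fsuc w))))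
             (common-≤-⊓ (column G fzero) (column G (fsuc w))))) (go G′) ⟩
      tri (c fzero) + ∑ (λ w → c fzero ⊓ c (fsuc w)) + weight (tabulate (c ∘ fsuc))
        ≡⟨ weight-tabulate-suc c ⟨
      weight (tabulate c) ∎
      where
      c = colDegrees G
      G′ = dropColumn G
      shared : Fin s → ℕ
      shared w = common (column G fzero) (column G (fsuc w))

  edges≡sum : ∀ {s} (G : BipartiteGraph r s) → edges G ≡ sum (tabulate (colDegrees G))
  edges≡sum G = begin
    edges G                               ≡⟨ ∑ₚ.sum-cong-≗ (λ u → ∣tabulate∣ (G u)) ⟩
    ∑ (λ u → ∑ λ w → indicator (G u w))   ≡⟨ ∑ₚ.∑-comm (λ u w → indicator (G u w)) ⟩
    ∑ (λ w → ∑ λ u → indicator (G u w))   ≡⟨ ∑ₚ.sum-cong-≗ (λ w → ∣tabulate∣ (column G w)) ⟨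
    ∑ (colDegrees G)                      ≡⟨ sum-tabulate (colDegrees G) ⟨
    sum (tabulate (colDegrees G))         ∎
    where open ≡-Reasoning

-- Graphs in which the neighbourhoods of W are initial segments of U

∑-<ᵇ : ∀ {r c} → c ≤ r → ∑ {r} (λ u → indicator (toℕ u <ᵇ c)) ≡ c
∑-<ᵇ {r} {zero} z≤n = ∑-zero r
∑-<ᵇ (s≤s c≤r)  = cong suc (∑-<ᵇ c≤r)

<ᵇ-⊓ : ∀ u c d → (u <ᵇ c) ∧ (u <ᵇ d) ≡ (u <ᵇ c ⊓ d)
<ᵇ-⊓ u       zero    d       = refl
<ᵇ-⊓ zero    (suc c) zero    = refl
<ᵇ-⊓ (suc u) (suc c) zero    = ∧-zeroʳ (u <ᵇ c)
<ᵇ-⊓ zero    (suc c) (suc d) = refl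
<ᵇ-⊓ (suc u) (suc c) (suc d) = <ᵇ-⊓ u c d

module _ {r : ℕ} where

  common-nested : ∀ {s} (G : BipartiteGraph r s) (c : Fin s → ℕ) → (∀ w → c w ≤ r) →
    (∀ u w → G u w ≡ (toℕ u <ᵇ c w)) → ∀ v w → common (column G v) (column G w) ≡ c v ⊓ c w
  common-nested G c c≤r G≡ v w = trans
    (∑ₚ.sum-cong-≗ (λ u → cong indicator (trans (cong₂ _∧_ (G≡ u v) (G≡ u w)) (<ᵇ-⊓ (toℕ u) (c v) (c w)))))
    (∑-<ᵇ (≤-trans (m⊓n≤m (c v) (c w)) (c≤r v)))

  -- Two initial segments intersect in the shorter one, so the estimate by the smaller degree is
  -- attained for every pair.
  N-S₂-nested : ∀ {s} (G : BipartiteGraph r s) (c : Fin s → ℕ) → (∀ w → c w ≤ r) →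
    (∀ u w → G u w ≡ (toℕ u <ᵇ c w)) → N-S₂ G ≡ weight (tabulate c)
  N-S₂-nested G c c≤r G≡ = begin
    N-S₂ G                                ≡⟨ N-S₂≡ G ⟩
    centredAtU G + ∑ (tri ∘ colDegrees G) ≡⟨ cong (centredAtU G +_) (∑ₚ.sum-cong-≗ (cong tri ∘ colDegree≡)) ⟩
    centredAtU G + ∑ (tri ∘ c)            ≡⟨ go G c c≤r G≡ ⟩
    weight (tabulate c)                   ∎
    where
    open ≡-Reasoning
    colDegree≡ : ∀ w → colDegrees G w ≡ c w
    colDegree≡ w = trans (∣tabulate∣ (column G w))
                     (trans (∑ₚ.sum-cong-≗ (λ u → cong indicator (G≡ u w))) (∑-<ᵇ (c≤r w)))
    go : ∀ {s} (G : BipartiteGraph r s) (c : Fin s → ℕ) → (∀ w → c w ≤ r) →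
         (∀ u w → G u w ≡ (toℕ u <ᵇ c w)) → centredAtU G + ∑ (tri ∘ c) ≡ weight (tabulate c)
    go {zero}  G c c≤r G≡ = trans (+-identityʳ _) (∑-zero r)
    go {suc s} G c c≤r G≡ = begin
      centredAtU G + (tri (c fzero) + ∑ (tri ∘ c ∘ fsuc))
        ≡⟨ cong (_+ (tri (c fzero) + ∑ (tri ∘ c ∘ fsuc))) (centredAtU-suc G) ⟩
      ∑ shared + centredAtU G′ + (tri (c fzero) + ∑ (tri ∘ c ∘ fsuc))
        ≡⟨ rearrange (∑ shared) _ (tri (c fzero)) _ ⟩
      tri (c fzero) + ∑ shared + (centredAtU G′ + ∑ (tri ∘ c ∘ fsuc))
        ≡⟨ cong₂ (λ a b → tri (c fzero) + a + b) (∑ₚ.sum-cong-≗ (λ w → common-nested G c c≤r G≡ fzero (fsuc w)))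
             (go G′ (c ∘ fsuc) (c≤r ∘ fsuc) (λ u → G≡ u ∘ fsuc)) ⟩
      tri (c fzero) + ∑ (λ w → c fzero ⊓ c (fsuc w)) + weight (tabulate (c ∘ fsuc))
        ≡⟨ weight-tabulate-suc c ⟨
      weight (tabulate c) ∎
      where
      G′ = dropColumn G
      shared : Fin s → ℕ
      shared w = common (column G fzero) (column G (fsuc w))

-- The default 0 makes the vertices of `W` beyond the list isolated.
nth : List ℕ → ℕ → ℕ
nth []       j       = 0
nth (x ∷ xs) zero    = x
nth (x ∷ xs) (suc j) = nth xs j

nth-≥ : ∀ xs {j} → length xs ≤ j → nth xs j ≡ 0
nth-≥ []       _       = refl
nth-≥ (x ∷ xs) (s≤s p) = nth-≥ xs p

nth-map : ∀ f xs {j} → j < length xs → nth (map f xs) j ≡ f (nth xs j)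
nth-map f (x ∷ xs) {zero}  _       = refl
nth-map f (x ∷ xs) {suc j} (s≤s p) = nth-map f xs p

nth-≤ : ∀ {r xs} → All (_≤ r) xs → ∀ j → nth xs j ≤ r
nth-≤ []       j       = z≤n
nth-≤ (p ∷ ps) zero    = p
nth-≤ (p ∷ ps) (suc j) = nth-≤ ps j

nth-replicate-0 : ∀ n j → nth (replicate n 0) j ≡ 0
nth-replicate-0 zero    j       = refl
nth-replicate-0 (suc n) zero    = refl
nth-replicate-0 (suc n) (suc j) = nth-replicate-0 n j

nth-heights-< : ∀ {p j k} q x → j < p → j < k → nth (heights p q x k) j ≡ x
nth-heights-< {suc p} {zero}  {suc k} q x _         _         = refl
nth-heights-< {suc p} {suc j} {suc k} q x (s≤s j<p) (s≤s j<k) = nth-heights-< q x j<p j<k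

nth-heights-≡ : ∀ {p k} q x → p < k → nth (heights p q x k) p ≡ q
nth-heights-≡ {zero}  {suc k} q x _         = refl
nth-heights-≡ {suc p} {suc k} q x (s≤s p<k) = nth-heights-≡ q x p<k

nth-heights-> : ∀ {p j} k q x → p < j → nth (heights p q x k) j ≡ 0
nth-heights-> zero q x _ = refl
nth-heights-> {zero}  {suc j} (suc k) q x _         = nth-replicate-0 k j
nth-heights-> {suc p} {suc j} (suc k) q x (s≤s p<j) = nth-heights-> k q x p<j

tabulate-nth : ∀ s xs → length xs ≤ s → tabulate {n = s} (nth xs ∘ toℕ) ≡ xs ++ replicate (s ∸ length xs) 0
tabulate-nth zero    []       _       = refl
tabulate-nth (suc s) []       _       = cong (0 ∷_) (tabulate-nth s [] z≤n)
tabulate-nth (suc s) (x ∷ xs) (s≤s p) = cong (x ∷_) (tabulate-nth s xs p)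

-- Empty columns weigh nothing, so a graph that uses only `k` of the `s` vertices of `W` is
-- described by `k` heights.
N-S₂-heights : ∀ {r s} (G : BipartiteGraph r s) xs → length xs ≤ s → All (_≤ r) xs →
  (∀ u w → G u w ≡ (toℕ u <ᵇ nth xs (toℕ w))) → N-S₂ G ≡ weight xs
N-S₂-heights {r} {s} G xs len xs≤r G≡ = begin
  N-S₂ G                                    ≡⟨ N-S₂-nested G (nth xs ∘ toℕ) (λ w → nth-≤ xs≤r (toℕ w)) G≡ ⟩
  weight (tabulate {n = s} (nth xs ∘ toℕ))  ≡⟨ cong weight (tabulate-nth s xs len) ⟩
  weight (xs ++ replicate d 0)              ≡⟨ weight-++ {0} {xs} (All.tabulate (λ _ → z≤n)) (Allₚ.replicate⁺ d z≤n) ⟩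
  weight xs + weight (replicate d 0) + length xs * sum (replicate d 0)
    ≡⟨ cong₂ (λ a b → weight xs + a + length xs * b) (weight-replicate-0 d) (sum-replicate-0 d) ⟩
  weight xs + 0 + length xs * 0             ≡⟨ lemma (weight xs) (length xs) ⟩
  weight xs                                 ∎
  where
  open ≡-Reasoning
  d = s ∸ length xs
  lemma : ∀ a b → a + 0 + b * 0 ≡ a
  lemma = solve-∀

splitBySubset : ∀ {s ℓ} (I : Subset s) (c : Fin s → ℕ) → (∀ {w} → w ∈ₛ I → ℓ ≤ c w) →
  ∃₂ λ xs ys → tabulate c ↭ xs ++ ys × length xs ≡ ∣ I ∣ × All (ℓ ≤_) xs
splitBySubset []            c ℓ≤ = [] , [] , ↭-refl , refl , []
splitBySubset (inside ∷ I)  c ℓ≤ with splitBySubset I (c ∘ fsuc) (ℓ≤ ∘ there)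
... | xs , ys , p , len , ps = c fzero ∷ xs , ys , prep (c fzero) p , cong suc len , ℓ≤ here ∷ ps
splitBySubset (outside ∷ I) c ℓ≤ with splitBySubset I (c ∘ fsuc) (ℓ≤ ∘ there)
... | xs , ys , p , len , ps =
  xs , c fzero ∷ ys , ↭-trans (prep (c fzero) p) (↭-sym (shift (c fzero) xs ys)) , len , ps

δ≤degree : ∀ {r s} (G : BipartiteGraph r s) (I : Subset s) {w} → w ∈ₛ I → δ G I ≤ degree G (inj₂ w)
δ≤degree {r} G I {w} w∈I = All.lookup (min≤xs r _)
  (∈-map⁺ (degree G ∘ inj₂) (∈-filter⁺ (_∈ₛ? I) (∈-allFin w) w∈I))

-- The extremal graphs

n≡m/n*n+m%n : ∀ n d .{{_ : NonZero d}} → n / d * d + n % d ≡ n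
n≡m/n*n+m%n n d = trans (+-comm _ (n % d)) (sym (m≡m%n+[m/n]*n n d))

j<length-heights : ∀ {j} p q x k → j < k → j < length (heights p q x k)
j<length-heights p q x k = subst (_ <_) (sym (length-heights p q x k))

-- Here `i` and `j` count from zero, whereas the subscripts in the graphs start at one; hence the
-- successors.
B-⇔ : ∀ {p q x k i j} → i < x → j < k →
  (suc j ≤ p ⊎ (suc j ≡ suc p × suc i ≤ q)) ⇔ i < nth (heights p q x k) j
B-⇔ {p} {q} {x} {k} {i} {j} i<x j<k with <-cmp j p
... | tri< j<p _ _ rewrite nth-heights-< q x j<p j<k = mk⇔ (λ _ → i<x) (λ _ → inj₁ j<p)
... | tri≈ j≮p refl _ rewrite nth-heights-≡ q x j<k = mk⇔
  (λ { (inj₁ j<p) → contradiction j<p j≮p ; (inj₂ (_ , i<q)) → i<q })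
  (λ i<q → inj₂ (refl , i<q))
... | tri> j≮p j≢p p<j rewrite nth-heights-> k q x p<j = mk⇔
  (λ { (inj₁ j<p) → contradiction j<p j≮p ; (inj₂ (j≡p , _)) → contradiction (suc-injective j≡p) j≢p })
  (λ ())

-- Above row `ℓ` lie packed columns of height `x`. If `p = k`, the partial column would be column
-- `k`, which `heights` drops and the condition `¬ p ≡ k` excludes.
B₁-⇔ : ∀ {ℓ p q x k i j} → p ≤ k → i < ℓ + x →
  (suc j ≤ p ⊎ (¬ p ≡ k × suc j ≡ suc p × suc i ≤ ℓ + q) ⊎ (suc i ≤ ℓ × p + 2 ≤ suc j × suc j ≤ k)) ⇔
  i < nth (map (ℓ +_) (heights p q x k)) j
B₁-⇔ {ℓ} {p} {q} {x} {k} {i} {j} p≤k i<r with j <? k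
... | no j≮k rewrite nth-≥ (map (ℓ +_) (heights p q x k))
        (subst (_≤ j) (sym (trans (length-map (ℓ +_) (heights p q x k)) (length-heights p q x k))) (≮⇒≥ j≮k)) = mk⇔
  (λ { (inj₁ j<p)                      → contradiction (<-≤-trans j<p p≤k) j≮k
     ; (inj₂ (inj₁ (p≢k , refl , _)))  → contradiction (≤∧≢⇒< p≤k p≢k) j≮k
     ; (inj₂ (inj₂ (_ , _ , j<k)))     → contradiction j<k j≮k })
  (λ ())
... | yes j<k rewrite nth-map (ℓ +_) (heights p q x k) (j<length-heights p q x k j<k) with <-cmp j p
...   | tri< j<p _ _ rewrite nth-heights-< q x j<p j<k = mk⇔ (λ _ → i<r) (λ _ → inj₁ j<p)
...   | tri≈ j≮p refl _ rewrite nth-heights-≡ q x j<k = mk⇔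
  (λ { (inj₁ j<p)                    → contradiction j<p j≮p
     ; (inj₂ (inj₁ (_ , _ , i<)))    → i<
     ; (inj₂ (inj₂ (_ , p+2≤j , _))) → contradiction (subst (_≤ suc j) (+-comm j 2) p+2≤j) (<-irrefl refl) })
  (λ i< → inj₂ (inj₁ (<⇒≢ j<k , refl , i<)))
...   | tri> j≮p j≢p p<j rewrite nth-heights-> k q x p<j | +-identityʳ ℓ = mk⇔
  (λ { (inj₁ j<p)                    → contradiction j<p j≮p
     ; (inj₂ (inj₁ (_ , j≡p , _)))   → contradiction (suc-injective j≡p) j≢p
     ; (inj₂ (inj₂ (i<ℓ , _ , _)))   → i<ℓ })
  (λ i<ℓ → inj₂ (inj₂ (i<ℓ , subst (_≤ suc j) (+-comm 2 p) (s≤s p<j) , j<k)))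

nth-heights-≥ : ∀ {p j} k x → p ≤ j → j < k → nth (heights p 0 x k) j ≡ 0
nth-heights-≥ k x p≤j j<k with m≤n⇒m<n∨m≡n p≤j
... | inj₁ p<j  = nth-heights-> k 0 x p<j
... | inj₂ refl = nth-heights-≡ 0 x j<k

B₂-⇔ : ∀ {t q k i j} → q ≤ k →
  ((suc i ≤ t × suc j ≤ k) ⊎ (suc i ≡ suc t × suc j ≤ q)) ⇔ i < nth (map (t +_) (heights q 0 1 k)) j
B₂-⇔ {t} {q} {k} {i} {j} q≤k with j <? k
... | no j≮k rewrite nth-≥ (map (t +_) (heights q 0 1 k))
        (subst (_≤ j) (sym (trans (length-map (t +_) (heights q 0 1 k)) (length-heights q 0 1 k))) (≮⇒≥ j≮k)) = mk⇔
  (λ { (inj₁ (_ , j<k)) → contradiction j<k j≮k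
     ; (inj₂ (_ , j<q)) → contradiction (<-≤-trans j<q q≤k) j≮k })
  (λ ())
... | yes j<k rewrite nth-map (t +_) (heights q 0 1 k) (j<length-heights q 0 1 k j<k) with j <? q
...   | yes j<q rewrite nth-heights-< 0 1 j<q j<k | +-comm t 1 = mk⇔
  (λ { (inj₁ (i<t , _)) → m<n⇒m<1+n i<t ; (inj₂ (refl , _)) → ≤-refl })
  (λ i<1+t → Sum.map (_, j<k) (λ i≡t → cong suc i≡t , j<q) (m≤n⇒m<n∨m≡n (s≤s⁻¹ i<1+t)))
...   | no j≮q rewrite nth-heights-≥ k 1 (≮⇒≥ j≮q) j<k | +-identityʳ t = mk⇔
  (λ { (inj₁ (i<t , _)) → i<t ; (inj₂ (_ , j<q)) → contradiction j<q j≮q })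
  (λ i<t → inj₁ (i<t , j<k))

N-S₂-B : ∀ r s m .{{_ : NonZero r}} → m ≤ s * r → N-S₂ (B r s m) ≡ packed r m
N-S₂-B r s m m≤ = begin
  N-S₂ (B r s m)            ≡⟨ N-S₂-heights (B r s m) (heights p q r s) (≤-reflexive (length-heights p q r s))
                                 (heights-≤ p s (m%n≤n m r))
                                 (λ u w → does-⇔ (B-⇔ (toℕ<n u) (toℕ<n w))
                                    (index w ≤? p ⊎-dec (index w ≟ suc p ×-dec index u ≤? q)) (toℕ u <? nth (heights p q r s) (toℕ w))) ⟩
  weight (heights p q r s)  ≡⟨ weight-heights p q r s (m%n≤n m r) (subst (_≤ s * r) (sym m≡) m≤) ⟩
  packed r (p * r + q)      ≡⟨ cong (λ z → packed r z) m≡ ⟩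
  packed r m                ∎
  where
  open ≡-Reasoning
  p = m / r
  q = m % r
  m≡ = n≡m/n*n+m%n m r

-- Above row `ℓ` the cells are packed in columns of the full height, so `B₁` attains the bound of
-- `weight-tall-≤` for `h = r ∸ ℓ`.
N-S₂-B₁ : ∀ r s m ℓ k .{{_ : NonZero (r ∸ ℓ)}} → ℓ ≤ r → k ≤ s → m ∸ k * ℓ ≤ k * (r ∸ ℓ) →
  N-S₂ (B₁ r s m ℓ k) ≡ rectangle ℓ k + ℓ * (m ∸ k * ℓ) + packed (r ∸ ℓ) (m ∸ k * ℓ)
N-S₂-B₁ r s m ℓ k ℓ≤r k≤s n≤ = begin
  N-S₂ (B₁ r s m ℓ k)
    ≡⟨ N-S₂-heights (B₁ r s m ℓ k) (map (ℓ +_) hs)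
         (subst (_≤ s) (sym (trans (length-map (ℓ +_) hs) (length-heights p q x k))) k≤s)
         (Allₚ.map⁺ (All.map (λ h≤x → ≤-trans (+-monoʳ-≤ ℓ h≤x) (≤-reflexive (m+[n∸m]≡n ℓ≤r))) (heights-≤ p k (m%n≤n n x))))
         (λ u w → does-⇔ (B₁-⇔ p≤k (subst (toℕ u <_) (sym (m+[n∸m]≡n ℓ≤r)) (toℕ<n u)))
            (index w ≤? p
             ⊎-dec (¬? (p ≟ k) ×-dec index w ≟ suc p ×-dec index u ≤? ℓ + q)
             ⊎-dec (index u ≤? ℓ ×-dec p + 2 ≤? index w ×-dec index w ≤? k))
            (toℕ u <? nth (map (ℓ +_) hs) (toℕ w))) ⟩
  weight (map (ℓ +_) hs)
    ≡⟨ weight-map-+ ℓ hs ⟩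
  rectangle ℓ (length hs) + ℓ * sum hs + weight hs
    ≡⟨ cong₂ (λ a b → rectangle ℓ a + ℓ * b + weight hs) (length-heights p q x k) (trans (sum-heights p q x k le) n≡) ⟩
  rectangle ℓ k + ℓ * n + weight hs
    ≡⟨ cong (rectangle ℓ k + ℓ * n +_) (trans (weight-heights p q x k (m%n≤n n x) le) (cong (λ z → packed x z) n≡)) ⟩
  rectangle ℓ k + ℓ * n + packed x n ∎
  where
  open ≡-Reasoning
  n = m ∸ k * ℓ
  x = r ∸ ℓ
  p = n / x
  q = n % x
  hs = heights p q x k
  n≡ = n≡m/n*n+m%n n x
  le : p * x + q ≤ k * x
  le = subst (_≤ k * x) (sym n≡) n≤
  p≤k : p ≤ k
  p≤k = *-cancelʳ-≤ p k x (≤-trans (m≤m+n _ q) le)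

-- Above row `ℓ` the cells are packed in rows of length `k`, so the same bound is attained for
-- `h = k`.
N-S₂-B₂ : ∀ r s m ℓ k .{{_ : NonZero k}} → ℓ ≤ r → k ≤ s → m ∸ k * ℓ ≤ k * (r ∸ ℓ) →
  N-S₂ (B₂ r s m ℓ k) ≡ rectangle ℓ k + ℓ * (m ∸ k * ℓ) + packed k (m ∸ k * ℓ)
N-S₂-B₂ r s m ℓ k ℓ≤r k≤s n≤ = begin
  N-S₂ (B₂ r s m ℓ k)
    ≡⟨ N-S₂-heights (B₂ r s m ℓ k) (map (ℓ + p +_) hs)
         (subst (_≤ s) (sym (trans (length-map (ℓ + p +_) hs) (length-heights q 0 1 k))) k≤s)
         (subst (All (_≤ r)) (sym lifted)
           (Allₚ.map⁺ (All.map (λ h≤x → ≤-trans (+-monoʳ-≤ ℓ h≤x) (≤-reflexive (m+[n∸m]≡n ℓ≤r))) (rows-≤ p q x k le))))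
         (λ u w → does-⇔ (B₂-⇔ (m%n≤n n k))
            ((index u ≤? ℓ + p ×-dec index w ≤? k) ⊎-dec (index u ≟ suc (ℓ + p) ×-dec index w ≤? q))
            (toℕ u <? nth (map (ℓ + p +_) hs) (toℕ w))) ⟩
  weight (map (ℓ + p +_) hs)
    ≡⟨ cong weight lifted ⟩
  weight (map (ℓ +_) rows)
    ≡⟨ weight-map-+ ℓ rows ⟩
  rectangle ℓ (length rows) + ℓ * sum rows + weight rows
    ≡⟨ cong₂ (λ a b → rectangle ℓ a + ℓ * b + weight rows) (trans (length-map (p +_) hs) (length-heights q 0 1 k))
         (trans (sum-rows p q k (m%n≤n n k)) n≡) ⟩
  rectangle ℓ k + ℓ * n + weight rows
    ≡⟨ cong (rectangle ℓ k + ℓ * n +_) (trans (weight-rows p q k (m%n≤n n k)) (cong (λ z → packed k z) n≡)) ⟩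
  rectangle ℓ k + ℓ * n + packed k n ∎
  where
  open ≡-Reasoning
  n = m ∸ k * ℓ
  x = r ∸ ℓ
  p = n / k
  q = n % k
  hs = heights q 0 1 k
  rows = map (p +_) hs
  lifted : map (ℓ + p +_) hs ≡ map (ℓ +_) rows
  lifted = map-+-+ ℓ p hs
  n≡ = n≡m/n*n+m%n n k
  le : p * k + q ≤ x * k
  le = subst₂ _≤_ (sym n≡) (*-comm k x) n≤

-- From the degrees in W to the three bounds

theorem1p8 : ∀ (r s ℓ k m : ℕ)
    .{{_ : NonZero r}} .{{_ : NonZero s}} .{{_ : NonZero ℓ}} .{{_ : NonZero k}} .{{_ : NonZero m}} →
    s ≤ r → k ≤ ℓ → ℓ ≤ r → k ≤ s → k * ℓ ≤ m → m ≤ r * s →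
    (G : BipartiteGraph r s) → edges G ≡ m →
    Σ[ I ∈ Subset s ] (∣ I ∣ ≡ k × ℓ ≤ δ G I) →
    (m ≤ r * k → (k+ℓ≤r : k + ℓ ≤ r) → N-S₂ G ≤ N-S₂ (B₁ r s m ℓ k {{k+ℓ≤r⇒r∸ℓ≢0 k+ℓ≤r}}))
    × (m ≤ r * k → r < k + ℓ → N-S₂ G ≤ N-S₂ (B₂ r s m ℓ k))
    × (r * k ≤ m → N-S₂ G ≤ N-S₂ (B r s m))
theorem1p8 r s ℓ k m s≤r k≤ℓ ℓ≤r k≤s kℓ≤m m≤rs G edges≡m (I , ∣I∣≡k , ℓ≤δ)
  with splitBySubset I (colDegrees G) (λ w∈I → ≤-trans ℓ≤δ (δ≤degree G I w∈I))
... | xs , ys , perm , len , ℓ≤xs =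
  (λ m≤rk k+ℓ≤r → bound₁ m≤rk k+ℓ≤r {{k+ℓ≤r⇒r∸ℓ≢0 k+ℓ≤r}}) , bound₂ , (λ _ → bound₃)
  where
  open ≤-Reasoning
  cs = tabulate (colDegrees G)
  x = r ∸ ℓ
  n = m ∸ k * ℓ

  ℓ+x≡r : ℓ + x ≡ r
  ℓ+x≡r = m+[n∸m]≡n ℓ≤r

  cs≤r : All (_≤ r) cs
  cs≤r = Allₚ.tabulate⁺ λ w → subst (_≤ r) (sym (∣tabulate∣ (column G w))) (∑-indicator-≤ (column G w))

  sum≡m : sum cs ≡ m
  sum≡m = trans (sym (edges≡sum G)) edges≡m

  length-xs : length xs ≡ k
  length-xs = trans len ∣I∣≡k

  size : length xs + length ys ≤ ℓ + x
  size = begin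
    length xs + length ys ≡⟨ length-++ xs ⟨
    length (xs ++ ys)     ≡⟨ ↭-length perm ⟨
    length cs             ≡⟨ length-tabulate (colDegrees G) ⟩
    s                     ≤⟨ s≤r ⟩
    r                     ≡⟨ ℓ+x≡r ⟨
    ℓ + x                 ∎

  n≤kx : m ≤ r * k → n ≤ k * x
  n≤kx m≤rk = begin
    m ∸ k * ℓ     ≤⟨ ∸-monoˡ-≤ (k * ℓ) (≤-trans m≤rk (≤-reflexive (*-comm r k))) ⟩
    k * r ∸ k * ℓ ≡⟨ *-distribˡ-∸ k r ℓ ⟨
    k * x         ∎

  -- The square of side `h` has to contain the box of `r ∸ ℓ` rows and `k` columns above row `ℓ`;
  -- the first two cases differ in which dimension is the larger.
  N≤ : ∀ h .{{_ : NonZero h}} → k ≤ h → x ≤ h → m ≤ r * k → N-S₂ G ≤ rectangle ℓ k + ℓ * n + packed h n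
  N≤ h k≤h x≤h m≤rk = begin
    N-S₂ G             ≤⟨ N-S₂≤weight G ⟩
    weight cs          ≡⟨ weight-↭ perm ⟩
    weight (xs ++ ys)  ≤⟨ weight-tall-≤ h ℓ x n xs ys (subst (_≤ h) (sym length-xs) k≤h) x≤h
                            (subst (_≤ ℓ) (sym length-xs) k≤ℓ) size
                            (subst (λ z → n ≤ z * x) (sym length-xs) (n≤kx m≤rk)) ℓ≤xs
                            (All-resp-↭ perm (subst (λ z → All (_≤ z) cs) (sym ℓ+x≡r) cs≤r))
                            (trans (sym (sum-↭ perm)) (trans sum≡m (trans (sym (m+[n∸m]≡n kℓ≤m))
                               (cong (λ z → z * ℓ + n) (sym length-xs))))) ⟩
    rectangle ℓ (length xs) + ℓ * n + packed h n
                       ≡⟨ cong (λ z → rectangle ℓ z + ℓ * n + packed h n) length-xs ⟩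
    rectangle ℓ k + ℓ * n + packed h n ∎
    where
    instance
      nz : NonZero (length xs)
      nz = subst NonZero (sym length-xs) (>-nonZero (>-nonZero⁻¹ k))

  bound₁ : m ≤ r * k → k + ℓ ≤ r → .{{_ : NonZero (r ∸ ℓ)}} → N-S₂ G ≤ N-S₂ (B₁ r s m ℓ k)
  -- `k + ℓ ≤ r` means `k ≤ r ∸ ℓ`, so the height of the box serves as the side.
  bound₁ m≤rk k+ℓ≤r = ≤-trans (N≤ x (m+n≤o⇒m≤o∸n k k+ℓ≤r) ≤-refl m≤rk)
    (≤-reflexive (sym (N-S₂-B₁ r s m ℓ k ℓ≤r k≤s (n≤kx m≤rk))))

  bound₂ : m ≤ r * k → r < k + ℓ → N-S₂ G ≤ N-S₂ (B₂ r s m ℓ k)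
  -- `r < k + ℓ` gives `r ∸ ℓ ≤ k`, so the width of the box serves as the side.
  bound₂ m≤rk r<k+ℓ = ≤-trans (N≤ k ≤-refl (m≤n+o⇒m∸n≤o r ℓ (subst (r ≤_) (+-comm k ℓ) (<⇒≤ r<k+ℓ))) m≤rk)
    (≤-reflexive (sym (N-S₂-B₂ r s m ℓ k ℓ≤r k≤s (n≤kx m≤rk))))

  bound₃ : N-S₂ G ≤ N-S₂ (B r s m)
  bound₃ = begin
    N-S₂ G             ≤⟨ N-S₂≤weight G ⟩
    -- All `s ≤ r` columns have height at most `r` and lie in a square of side `r`.
    weight cs          ≤⟨ weight≤packed r cs (subst (_≤ r) (sym (length-tabulate (colDegrees G))) s≤r) cs≤r ⟩
    packed r (sum cs)  ≡⟨ cong (λ z → packed r z) sum≡m ⟩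
    packed r m         ≡⟨ N-S₂-B r s m (≤-trans m≤rs (≤-reflexive (*-comm r s))) ⟨
    N-S₂ (B r s m)     ∎
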